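{- Assume the Exponential Time Hypothesis (ETH). Then there is no algorithm that solves \textsc{Independent Set} on every input graph $G$ in time $2^{o(\mathrm{lrw}^2)} n^{O(1)}$, where $n=|V(G)|$ and $\mathrm{lrw}$ is the linear rank-width of $G$.
   Context: Graphs are finite, simple and undirected. \textsc{Independent Set}: given a graph $G$, find an independent set (a set of pairwise non-adjacent vertices) of maximum size. ETH: there is a constant $\delta>0$ such that \textsc{3-CNF-SAT} on $N$ variables cannot be solved in time $2^{\delta N}$ times a polynomial in the size of the formula. For disjoint $A,B\subseteq V(G)$, the cut-rank $\mathrm{rw}(A,B)$ is the rank over $\mathbb{F}_2$ of the $|A|\times|B|$ 0-1 matrix whose $(a,b)$ entry is $1$ iff $ab\in E(G)$; put $\mathrm{rw}(A)=\mathrm{rw}(A,V(G)\setminus A)$. The width of a permutation of $V(G)$ is the maximum of $\mathrm{rw}(A)$ over all prefixes $A$ of the permutation. The linear rank-width of $G$ is the minimum width of a permutation of $V(G)$. A running time $2^{o(\mathrm{lrw}^2)}n^{O(1)}$ means a bound $2^{g(\mathrm{lrw})}n^{c}$ for some constant $c$ and some function $g$ with $g(k)/k^2\to 0$ as $k\to\infty$. -}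

module Defs where

open import Algebra.Bundles using (CommutativeRing)
import Algebra.Properties.Monoid.Sum as MonoidSum
open import Data.Bool using (Bool; true; false; if_then_else_; not)
open import Data.Bool.Properties using (xor-∧-commutativeRing)
import Data.Bool.Properties as Bool
open import Data.Fin using (Fin; zero; suc; toℕ; punchIn)
import Data.Fin.Properties as Fin
open import Data.Fin.Permutation
  using (Permutation′; _⟨$⟩ʳ_; insert; remove; insert-remove; _≈_)
import Data.Fin.Permutation as Perm
open import Data.Fin.Subset using (Subset; inside; outside; _∈_; _⊆_; ⊥; ∁; ∣_∣)
open import Data.Fin.Subset.Properties using (_⊆?_; anySubset?; ∉⊥; ⊆-antisym; ∣⊥∣≡0)
open import Data.List using (List; []; _∷_; _++_; map; filter; upTo; cartesianProductWith; allFin)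
import Data.List.Membership.Propositional as List
open import Data.List.Properties using (map-cong)
open import Data.List.Membership.Propositional.Properties
  using (∈-map⁺; ∈-map⁻; ∈-++⁺ˡ; ∈-++⁺ʳ; ∈-filter⁺; ∈-filter⁻; ∈-allFin; ∈-cartesianProductWith⁺)
import Data.List.Relation.Unary.All as All
open import Data.List.Relation.Unary.Any using (Any; here; there)
import Data.List.Relation.Unary.Any as Any
open import Data.List.Extrema.Nat
  using (min; max; xs≤max; min≤v⁺; argmin-sel; argmax-sel)
open import Data.Nat
  using (ℕ; zero; suc; _+_; _*_; _^_; _⊔_; _≤_; _<_; _<?_)
import Data.Nat.Properties as ℕ
open import Data.Product using (∃-syntax; _×_; _,_; proj₁; proj₂)
open import Data.Sum using (inj₁; inj₂)
open import Data.Vec using (Vec; []; _∷_; lookup; tabulate; replicate; _[_]≔_)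
import Data.Vec as Vec
import Data.Vec.Properties as Vec
open import Data.Vec.Bounded using (Vec≤)
import Data.Vec.Bounded as Vec≤
open import Function using (id; _∘_)
open import Level using (0ℓ)
open import Relation.Binary.PropositionalEquality
  using (_≡_; refl; sym; trans; cong)
open import Relation.Nullary using (¬_; Dec; does; Reflects; contradiction)
open import Relation.Nullary.Decidable using (¬?; map′; _→-dec_; decidable-stable)
open import Relation.Unary using (Pred; Decidable)

------------------------------------------------------------------------
-- Algorithms
--
-- The machine model is N. D. Jones' WHILE language ("Computability and
-- Complexity from a Programming Perspective", 1997): imperative
-- programs whose finitely many variables range over binary trees.
-- With unit cost for each tree operation it simulates, and is simulated
-- by, multi-tape Turing machines with polynomial overhead (values are
-- represented by pointers into a shared heap, so that a single step
-- adds only a bounded number of heap cells).  Such an overhead only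
-- multiplies δ in ETH, and g and c in a bound 2 ^ g(lrw) * n ^ c, by
-- constants, so that neither notion depends on the choice of model.

infixr 5 _∙_

data Tree : Set where
  nil : Tree
  _∙_ : Tree → Tree → Tree

head : Tree → Tree
head nil     = nil
head (l ∙ r) = l

tail : Tree → Tree
tail nil     = nil
tail (l ∙ r) = r

data Expr (k : ℕ) : Set where
  var  : Fin k → Expr k
  nil  : Expr k
  cons : Expr k → Expr k → Expr k
  hd   : Expr k → Expr k
  tl   : Expr k → Expr k

infix  6 _≔_
infixr 5 _⨾_

data Command (k : ℕ) : Set where
  _≔_   : Fin k → Expr k → Command k
  _⨾_   : Command k → Command k → Command k
  cond  : Expr k → Command k → Command k → Command k
  while : Expr k → Command k → Command k

Store : ℕ → Set
Store k = Vec Tree k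

eval : ∀ {k} → Store k → Expr k → Tree
eval σ (var x)    = lookup σ x
eval σ nil        = nil
eval σ (cons d e) = eval σ d ∙ eval σ e
eval σ (hd e)     = head (eval σ e)
eval σ (tl e)     = tail (eval σ e)

cost : ∀ {k} → Expr k → ℕ
cost (var x)    = 1
cost nil        = 1
cost (cons d e) = 1 + cost d + cost e
cost (hd e)     = 1 + cost e
cost (tl e)     = 1 + cost e

-- "C ⊢ σ ⇒ τ [ t ]": started in store σ, C halts in store τ after t
-- steps.  A test counts as false exactly when its value is nil.

infix 4 _⊢_⇒_[_]

data _⊢_⇒_[_] {k : ℕ} : Command k → Store k → Store k → ℕ → Set where
  assign : ∀ {σ} x e →
    x ≔ e ⊢ σ ⇒ σ [ x ]≔ eval σ e [ suc (cost e) ]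
  sequence : ∀ {C D σ τ υ s t} →
    C ⊢ σ ⇒ τ [ s ] → D ⊢ τ ⇒ υ [ t ] →
    C ⨾ D ⊢ σ ⇒ υ [ s + t ]
  cond-true : ∀ {e C D σ τ l r t} →
    eval σ e ≡ l ∙ r → C ⊢ σ ⇒ τ [ t ] →
    cond e C D ⊢ σ ⇒ τ [ suc (cost e) + t ]
  cond-false : ∀ {e C D σ τ t} →
    eval σ e ≡ nil → D ⊢ σ ⇒ τ [ t ] →
    cond e C D ⊢ σ ⇒ τ [ suc (cost e) + t ]
  while-true : ∀ {e C σ τ υ l r s t} →
    eval σ e ≡ l ∙ r → C ⊢ σ ⇒ τ [ s ] → while e C ⊢ τ ⇒ υ [ t ] →
    while e C ⊢ σ ⇒ υ [ suc (cost e) + s + t ]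
  while-false : ∀ {e C σ} →
    eval σ e ≡ nil →
    while e C ⊢ σ ⇒ σ [ suc (cost e) ]

-- Variable zero holds the input at the start and the output at the end;
-- the other variables are initially nil.

record Program : Set where
  constructor program
  field
    {extra} : ℕ
    body    : Command (suc extra)

_on_yields_after_ : Program → Tree → Tree → ℕ → Set
program {k} C on input yields output after t =
  ∃[ σ ] C ⊢ input ∷ replicate k nil ⇒ output ∷ σ [ t ]

------------------------------------------------------------------------
-- Encodings of inputs and outputs

encodeBool : Bool → Tree
encodeBool false = nil
encodeBool true  = nil ∙ nil

encodeℕ : ℕ → Tree
encodeℕ zero    = nil
encodeℕ (suc n) = nil ∙ encodeℕ n

encodeVec : ∀ {A : Set} {n} → (A → Tree) → Vec A n → Tree
encodeVec f []       = nil
encodeVec f (x ∷ xs) = f x ∙ encodeVec f xs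

encodeList : ∀ {A : Set} → (A → Tree) → List A → Tree
encodeList f []       = nil
encodeList f (x ∷ xs) = f x ∙ encodeList f xs

encodeSubset : ∀ {n} → Subset n → Tree
encodeSubset = encodeVec encodeBool

treeSize : Tree → ℕ
treeSize nil     = 1
treeSize (l ∙ r) = 1 + treeSize l + treeSize r

------------------------------------------------------------------------
-- 3-CNF-SAT and the Exponential Time Hypothesis

record Literal (N : ℕ) : Set where
  constructor literal
  field
    positive : Bool
    variableOf : Fin N

Clause : ℕ → Set
Clause N = Vec≤ (Literal N) 3

3-CNF : ℕ → Set
3-CNF N = List (Clause N)

Assignment : ℕ → Set
Assignment N = Vec Bool N

literalValue : ∀ {N} → Assignment N → Literal N → Bool
literalValue α (literal p x) = if p then lookup α x else not (lookup α x)

_⊨_ : ∀ {N} → Assignment N → 3-CNF N → Set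
α ⊨ φ = All.All (λ C → Any (λ ℓ → literalValue α ℓ ≡ true) (Vec≤.toList C)) φ

Satisfiable : ∀ {N} → 3-CNF N → Set
Satisfiable φ = ∃[ α ] α ⊨ φ

encodeLiteral : ∀ {N} → Literal N → Tree
encodeLiteral (literal p x) = encodeBool p ∙ encodeℕ (toℕ x)

encodeClause : ∀ {N} → Clause N → Tree
encodeClause C = encodeList encodeLiteral (Vec≤.toList C)

encodeFormula : ∀ {N} → 3-CNF N → Tree
encodeFormula {N} φ = encodeℕ N ∙ encodeList encodeClause φ

-- Variables are written in unary.  Compared with a binary encoding this
-- increases the size by a factor polynomial in N, which is dominated by
-- 2 ^ (ε * N) for every ε > 0 and hence does not affect ETH.

size : ∀ {N} → 3-CNF N → ℕ
size φ = treeSize (encodeFormula φ)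

-- P decides 3-CNF-SAT in time 2 ^ ((p / q) * N) * size ^ c.  Raising
-- both sides to the power q avoids the fractional exponent.  As sizes
-- are at least 3, every polynomial in the size is bounded by some
-- size ^ c.

SolvesSATIn : Program → (p q c : ℕ) → Set
SolvesSATIn P p q c =
  ∀ {N} (φ : 3-CNF N) → ∃[ b ] ∃[ t ]
    (P on encodeFormula φ yields encodeBool b after t) ×
    Reflects (Satisfiable φ) b ×
    t ^ q ≤ 2 ^ (p * N) * (size φ ^ c) ^ q

-- The constant δ is taken to be a positive rational p / q: if the
-- hypothesis holds for some δ then also for every smaller positive one.

ETH : Set
ETH = ∃[ p ] ∃[ q ] 0 < p × 0 < q × ¬ (∃[ P ] ∃[ c ] SolvesSATIn P p q c)

------------------------------------------------------------------------
-- Graphs and Independent Set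

record Graph (n : ℕ) : Set where
  field
    edge   : Fin n → Fin n → Bool
    symm   : ∀ u v → edge u v ≡ edge v u
    irrefl : ∀ v → edge v v ≡ false

open Graph public

-- The rows of the adjacency matrix.

encodeGraph : ∀ {n} → Graph n → Tree
encodeGraph G = encodeVec encodeSubset (tabulate (tabulate ∘ edge G))

IsIndependent : ∀ {n} → Graph n → Subset n → Set
IsIndependent G S = ∀ {u v} → u ∈ S → v ∈ S → edge G u v ≡ false

IsMaximumIndependent : ∀ {n} → Graph n → Subset n → Set
IsMaximumIndependent G S =
  IsIndependent G S × (∀ T → IsIndependent G T → ∣ T ∣ ≤ ∣ S ∣)

SolvesIndependentSetIn : Program → (∀ {n} → Graph n → ℕ) → Set
SolvesIndependentSetIn P bound =
  ∀ {n} (G : Graph n) → ∃[ S ] ∃[ t ]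
    (P on encodeGraph G yields encodeSubset S after t) ×
    IsMaximumIndependent G S ×
    t ≤ bound G

------------------------------------------------------------------------
-- Rank over 𝔽₂

𝔽₂ : CommutativeRing 0ℓ 0ℓ
𝔽₂ = xor-∧-commutativeRing

private
  module F = CommutativeRing 𝔽₂
open MonoidSum F.+-monoid using (sum)

Matrix : ℕ → ℕ → Set
Matrix m n = Fin m → Fin n → F.Carrier

-- A vector of coefficients in 𝔽₂ is the same thing as a subset, its
-- support.

combination : ∀ {m n} → Matrix m n → Subset m → Fin n → F.Carrier
combination M c j = sum (λ i → lookup c i F.* M i j)

RowsIndependent : ∀ {m n} → Matrix m n → Subset m → Set
RowsIndependent M S =
  ∀ c → c ⊆ S → (∀ j → combination M c j ≡ F.0#) → c ≡ ⊥

allSubset? : ∀ {n} {P : Pred (Subset n) 0ℓ} → Decidable P → Dec (∀ c → P c)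
allSubset? P? = map′
  (λ none c → decidable-stable (P? c) (λ ¬p → none (c , ¬p)))
  (λ all (c , ¬p) → ¬p (all c))
  (¬? (anySubset? (¬? ∘ P?)))

rowsIndependent? : ∀ {m n} (M : Matrix m n) → Decidable (RowsIndependent M)
rowsIndependent? M S = allSubset? λ c →
  (c ⊆? S) →-dec
  (Fin.all? (λ j → combination M c j Bool.≟ F.0#) →-dec
  Vec.≡-dec Bool._≟_ c ⊥)

subsets : ∀ n → List (Subset n)
subsets zero    = [] ∷ []
subsets (suc n) = map (inside ∷_) (subsets n) ++ map (outside ∷_) (subsets n)

rank : ∀ {m n} → Matrix m n → ℕ
rank {m} M = max 0 (map ∣_∣ (filter (rowsIndependent? M) (subsets m)))

------------------------------------------------------------------------
-- Linear rank-width

-- The elements of a subset, in increasing order.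

element : ∀ {n} (A : Subset n) → Fin ∣ A ∣ → Fin n
element (inside  ∷ A) zero    = zero
element (inside  ∷ A) (suc i) = suc (element A i)
element (outside ∷ A) i       = suc (element A i)

cutMatrix : ∀ {n} → Graph n → (A B : Subset n) → Matrix ∣ A ∣ ∣ B ∣
cutMatrix G A B i j = edge G (element A i) (element B j)

rw : ∀ {n} → Graph n → (A B : Subset n) → ℕ
rw G A B = rank (cutMatrix G A B)

cutRank : ∀ {n} → Graph n → Subset n → ℕ
cutRank G A = rw G A (∁ A)

-- An ordering of the vertices is given by π with π ⟨$⟩ʳ v the position
-- of v, counted from 0.

prefix : ∀ {n} → Permutation′ n → ℕ → Subset n
prefix π i = tabulate (λ v → does (toℕ (π ⟨$⟩ʳ v) <? i))

width : ∀ {n} → Graph n → Permutation′ n → ℕ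
width {n} G π = max 0 (map (cutRank G ∘ prefix π) (upTo (suc n)))

-- All permutations up to pointwise equality, see permutations-complete.

permutations : ∀ n → List (Permutation′ n)
permutations zero    = Perm.id ∷ []
permutations (suc n) = cartesianProductWith (insert zero) (allFin (suc n)) (permutations n)

-- The first argument of min also takes part in the minimum, so it must
-- itself be the width of a permutation.

lrw : ∀ {n} → Graph n → ℕ
lrw {n} G = min (width G Perm.id) (map (width G) (permutations n))

------------------------------------------------------------------------
-- The enumerations in rank and lrw are exhaustive

subsets-complete : ∀ {n} (S : Subset n) → S List.∈ subsets n
subsets-complete []            = here refl
subsets-complete (inside  ∷ S) = ∈-++⁺ˡ (∈-map⁺ (inside ∷_) (subsets-complete S))
subsets-complete (outside ∷ S) =
  ∈-++⁺ʳ (map (inside ∷_) (subsets _)) (∈-map⁺ (outside ∷_) (subsets-complete S))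

rank-upper : ∀ {m n} (M : Matrix m n) S → RowsIndependent M S → ∣ S ∣ ≤ rank M
rank-upper M S ind = All.lookup (xs≤max 0 _)
  (∈-map⁺ ∣_∣ (∈-filter⁺ (rowsIndependent? M) (subsets-complete S) ind))

rank-attained : ∀ {m n} (M : Matrix m n) → ∃[ S ] RowsIndependent M S × ∣ S ∣ ≡ rank M
rank-attained {m} M
  with argmax-sel id 0 (map ∣_∣ (filter (rowsIndependent? M) (subsets m)))
... | inj₁ eq =
  ⊥ , (λ c c⊆⊥ _ → ⊆-antisym c⊆⊥ (λ x∈⊥ → contradiction x∈⊥ ∉⊥)) , trans (∣⊥∣≡0 m) (sym eq)
... | inj₂ r∈ with S , S∈ , eq ← ∈-map⁻ ∣_∣ r∈ =
  S , proj₂ (∈-filter⁻ (rowsIndependent? M) {xs = subsets m} S∈) , sym eq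

insert-cong : ∀ {n} j {π ρ : Permutation′ n} → π ≈ ρ →
              insert zero j π ≈ insert zero j ρ
insert-cong j π≈ρ zero    = refl
insert-cong j π≈ρ (suc i) = cong (punchIn j) (π≈ρ i)

permutations-complete : ∀ {n} (π : Permutation′ n) →
                        ∃[ ρ ] ρ List.∈ permutations n × ρ ≈ π
permutations-complete {zero}  π = Perm.id , here refl , λ ()
permutations-complete {suc n} π
  with ρ , ρ∈ , ρ≈ ← permutations-complete (remove zero π) =
  insert zero (π ⟨$⟩ʳ zero) ρ ,
  ∈-cartesianProductWith⁺ (insert zero) (∈-allFin _) ρ∈ ,
  λ i → trans (insert-cong (π ⟨$⟩ʳ zero) {ρ} {remove zero π} ρ≈ i)
              (insert-remove zero π i)

width-cong : ∀ {n} (G : Graph n) {π ρ : Permutation′ n} → π ≈ ρ → width G π ≡ width G ρ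
width-cong {n} G {π} {ρ} π≈ρ = cong (max 0) (map-cong
  (λ i → cong (cutRank G) (Vec.tabulate-cong (λ v → cong (λ p → does (toℕ p <? i)) (π≈ρ v))))
  (upTo (suc n)))

min-lower : ∀ d {x xs} → x List.∈ xs → min d xs ≤ x
min-lower d {xs = xs} x∈ = min≤v⁺ d xs (inj₂ (Any.map (ℕ.≤-reflexive ∘ sym) x∈))

min-attained : ∀ {A : Set} (f : A → ℕ) a as → ∃[ b ] f b ≡ min (f a) (map f as)
min-attained f a as with argmin-sel id (f a) (map f as)
... | inj₁ eq = a , sym eq
... | inj₂ r∈ with b , _ , eq ← ∈-map⁻ f r∈ = b , sym eq

lrw-lower : ∀ {n} (G : Graph n) π → lrw G ≤ width G π
lrw-lower {n} G π = lower (permutations-complete π)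
  where
  lower : ∃[ ρ ] ρ List.∈ permutations n × ρ ≈ π → lrw G ≤ width G π
  lower (ρ , ρ∈ , ρ≈π) = ℕ.≤-trans
    (min-lower (width G Perm.id) (∈-map⁺ (width G) ρ∈))
    (ℕ.≤-reflexive (width-cong G {ρ} {π} ρ≈π))

lrw-attained : ∀ {n} (G : Graph n) → ∃[ π ] width G π ≡ lrw G
lrw-attained {n} G = min-attained (width G) Perm.id (permutations n)

------------------------------------------------------------------------
-- Asymptotics

-- g k / k ^ 2 → 0: eventually g k / k ^ 2 ≤ 1 / m, for every m.
-- Integer-valued g suffice, since a running time bounded using a
-- real-valued g is also bounded using k ↦ max 0 ⌈g k⌉.

_∈o[k²] : (ℕ → ℕ) → Set
g ∈o[k²] = ∀ m → ∃[ K ] ∀ k → K ≤ k → m * g k ≤ k ^ 2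

-- 2 ^ g(lrw) * n ^ c, except that n = 0 is treated like n = 1: otherwise
-- the bound for the graph without vertices would be 0 steps, which no
-- program meets.

timeBound : (ℕ → ℕ) → ℕ → ∀ {n} → Graph n → ℕ
timeBound g c {n} G = 2 ^ g (lrw G) * (n ⊔ 1) ^ c

{-# OPTIONS --safe #-}

-- Encode an assignment of N variables as a symmetric k × k matrix Y over
-- 𝔽₂ with k = O(√N).  A vertex (i , y) claims that row i of Y is y; two
-- such claims (i , y) and (j , z) are consistent when y j = z i, and
-- inconsistent ones are adjacent.  Every clause, including an added
-- tautology x ∨ ¬x for each variable x, contributes a clique of those
-- claims that make one of its literals true, so the formula is
-- satisfiable iff some independent set meets all cliques.  Consistency
-- is the vanishing of the symplectic form on 𝔽₂ᵏ × 𝔽₂ᵏ at (e i , y) and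
-- (e j , z), which has rank 2k whatever the number of clauses, and a
-- prefix of the vertices cuts at most one clique.  Hence the linear
-- rank-width is O(√N), while the number of vertices is 2^O(√N) times a
-- polynomial.

module Submission where

open import Algebra.Bundles using (CommutativeRing)
import Algebra.Properties.CommutativeSemigroup as CommutativeSemigroup
import Algebra.Properties.Monoid.Sum as MonoidSum
open import Data.Bool using (Bool; true; false; if_then_else_; not; _xor_; _∧_; T)
import Data.Bool.Properties as Bool
open import Data.Bool.Properties
  using (if-float; xor-comm; xor-same; ∧-distribˡ-xor; ∧-distribʳ-xor; ∧-zeroʳ; ∧-identityʳ)
open import Data.Fin using (Fin; zero; suc; toℕ; fromℕ<; punchIn; punchOut; combine; remQuot)
import Data.Fin as Fin
import Data.Fin.Permutation as Perm
import Data.Fin.Properties as Fin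
open import Data.Fin.Subset using (Subset; ∣_∣; inside; outside; ⊥; ∁; _⊆_)
import Data.Fin.Subset as Subset
import Data.Fin.Subset.Properties as Subset
open import Data.List using (List; []; _∷_; _++_; map; foldr; concatMap; length; lookup; upTo)
open import Data.List.Extrema.Nat using (max≤v⁺)
open import Data.List.Membership.Propositional using (_∈_; find; lose)
open import Data.List.Membership.Propositional.Properties
  using (∈-map⁺; ∈-map⁻; ∈-concatMap⁺; ∈-concatMap⁻; ∈-lookup)
open import Data.List.Properties using (++-assoc; ++-identityʳ; length-++; length-map)
open import Data.List.Relation.Unary.All as All using (All; []; _∷_)
import Data.List.Relation.Unary.All.Properties as All
open import Data.List.Relation.Unary.AllPairs as AllPairs using (AllPairs; []; _∷_)
import Data.List.Relation.Unary.AllPairs.Properties as AllPairs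
open import Data.List.Relation.Unary.Any as Any using (here; there)
open import Data.Nat
  using (ℕ; zero; suc; _+_; _*_; _^_; _∸_; _⊔_; _⊓_; _≤_; _<_; z≤n; s≤s; _≡ᵇ_; _≤?_; NonZero; >-nonZero)
import Data.Nat.Properties as ℕ
open import Data.Nat.Tactic.RingSolver using (solve-∀)
open import Data.Product using (∃-syntax; _×_; _,_; proj₁; proj₂)
open import Data.Sum using (_⊎_; inj₁; inj₂)
open import Data.Vec using (Vec; []; _∷_; tabulate; replicate; zipWith)
import Data.Vec as Vec
import Data.Vec.Bounded as Vec≤
import Data.Vec.Properties as Vec
open import Defs
open import Function using (_∘_; Injective)
open import Relation.Binary.PropositionalEquality
  using (_≡_; _≢_; _≗_; refl; sym; trans; cong; cong₂; subst)
open import Relation.Nullary using (¬_; Dec; yes; no; does; contradiction; Reflects)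
open import Relation.Nullary.Decidable using (map′; recompute; dec-true)

-- A language with folds and its compilation

-- As lrw² = O(N), a bound 2 ^ o(lrw²) is 2 ^ o(N), and a fixed power of 2 ^ O(√N) is 2 ^ o(N) as
-- well. A claim carries a whole row rather than one bit, so that comparing two claims is a bilinear
-- condition; this makes the rank independent of the number of clauses, at the price of 2 ^ k
-- candidates per literal. Two claims about the same row i are compared only in column i. In another
-- column j they can be linked only through a claim about row j, so every row that holds a variable
-- has to be claimed; this is what the tautologies achieve. ETH speaks of concrete programs, so the
-- reduction has to be one, with a proven running time. It is written in a language whose only loops
-- are folds: a bound on the lengths of the traversed lists gives a polynomial time bound that is
-- read off the term, and evaluation proofs never count steps.

data Term (n : ℕ) : Set where
  return : Expr n → Term n
  bind   : Term n → Term (suc n) → Term n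
  branch : Expr n → Term n → Term n → Term n
  fold   : Expr n → Expr n → Term (2 + n) → Term n
  call   : ∀ {k} → Term k → Vec (Expr n) k → Term n

-- Unary numbers and lists are both traversed along the right spine, so a fold over a number serves
-- as a counting loop.
spine : Tree → ℕ
spine nil     = 0
spine (l ∙ r) = suc (spine r)

-- In "Evaluates W ρ e v", all lists traversed by folds have at most W
-- entries, so that e and W alone bound the running time.

data Evaluates (W : ℕ) : ∀ {n} → Store n → Term n → Tree → Set
data Folds (W : ℕ) {n} (ρ : Store n) (z : Tree) (e : Term (2 + n)) : Tree → Tree → Set

data Evaluates W where
  return : ∀ {n} {ρ : Store n} e → Evaluates W ρ (return e) (eval ρ e)
  bind   : ∀ {n} {ρ : Store n} {d e v w} →
    Evaluates W ρ d v → Evaluates W (v ∷ ρ) e w → Evaluates W ρ (bind d e) w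
  branch-true : ∀ {n} {ρ : Store n} {c d e l r v} →
    eval ρ c ≡ l ∙ r → Evaluates W ρ d v → Evaluates W ρ (branch c d e) v
  branch-false : ∀ {n} {ρ : Store n} {c d e v} →
    eval ρ c ≡ nil → Evaluates W ρ e v → Evaluates W ρ (branch c d e) v
  fold   : ∀ {n} {ρ : Store n} {l i e v} → spine (eval ρ l) ≤ W →
    Folds W ρ (eval ρ i) e (eval ρ l) v → Evaluates W ρ (fold l i e) v
  call   : ∀ {n k} {ρ : Store n} {e : Term k} {es v} →
    Evaluates W (Vec.map (eval ρ) es) e v → Evaluates W ρ (call e es) v

data Folds W ρ z e where
  []  : Folds W ρ z e nil z
  _∷_ : ∀ {l r v w} → Evaluates W (l ∷ v ∷ ρ) e w → Folds W ρ z e r v → Folds W ρ z e (l ∙ r) w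

_⊢_⇒_within_ : ∀ {k} → Command k → Store k → Store k → ℕ → Set
C ⊢ σ ⇒ τ within T = ∃[ t ] (C ⊢ σ ⇒ τ [ t ]) × t ≤ T

infixr 5 _then_

_then_ : ∀ {k} {C D : Command k} {σ τ υ S T} →
  C ⊢ σ ⇒ τ within S → D ⊢ τ ⇒ υ within T → (C ⨾ D) ⊢ σ ⇒ υ within (S + T)
(s , p , s≤) then (t , q , t≤) = s + t , sequence p q , ℕ.+-mono-≤ s≤ t≤

assigns : ∀ {k} {σ : Store k} x e → (x ≔ e) ⊢ σ ⇒ σ Vec.[ x ]≔ eval σ e within suc (cost e)
assigns x e = _ , assign x e , ℕ.≤-refl

weaken : ∀ {k} {C : Command k} {σ τ S T} → S ≤ T →
  C ⊢ σ ⇒ τ within S → C ⊢ σ ⇒ τ within T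
weaken S≤T (t , p , t≤) = t , p , ℕ.≤-trans t≤ S≤T

stop : ∀ {k} {e : Expr k} {C σ} → eval σ e ≡ nil → while e C ⊢ σ ⇒ σ within suc (cost e)
stop eq = _ , while-false eq , ℕ.≤-refl

loop : ∀ {k} {e : Expr k} {C σ τ υ l r S T} → eval σ e ≡ l ∙ r →
  C ⊢ σ ⇒ τ within S → while e C ⊢ τ ⇒ υ within T →
  while e C ⊢ σ ⇒ υ within (suc (cost e) + S + T)
loop {e = e} eq (s , p , s≤) (t , q , t≤) =
  _ , while-true eq p q , ℕ.+-mono-≤ (ℕ.+-monoʳ-≤ (suc (cost e)) s≤) t≤

module _ {m : ℕ} where

  -- The environment of a term is a stack held in variable zero. The second stack has one list for
  -- each enclosing fold. The remaining `m` variables belong to the given program and are never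
  -- touched.
  stack aux : Expr (2 + m)
  stack = var zero
  aux   = var (suc zero)

  drops : ℕ → Expr (2 + m)
  drops zero    = stack
  drops (suc i) = tl (drops i)

  private
    index : ∀ {n} → Fin n → ℕ
    index zero    = zero
    index (suc i) = suc (index i)

  onStack : ∀ {n} → Expr n → Expr (2 + m)
  onStack (var x)    = hd (drops (index x))
  onStack nil        = nil
  onStack (cons d e) = cons (onStack d) (onStack e)
  onStack (hd e)     = hd (onStack e)
  onStack (tl e)     = tl (onStack e)

  pushAll : ∀ {n k} → Vec (Expr n) k → Expr (2 + m)
  pushAll []       = stack
  pushAll (e ∷ es) = cons (onStack e) (pushAll es)

  -- The top of the second stack is the part of a list that a fold still
  -- has to process.

  reverseBody : Command (2 + m)
  reverseBody =
    suc zero ≔ cons (cons (hd (hd stack)) (hd aux)) (tl aux) ⨾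
    zero ≔ cons (tl (hd stack)) (tl stack)

  foldBody : Command (2 + m) → Command (2 + m)
  foldBody C =
    zero ≔ cons (hd (hd aux)) stack ⨾
    suc zero ≔ cons (tl (hd aux)) (tl aux) ⨾
    C ⨾
    zero ≔ cons (hd stack) (tl (tl (tl stack)))

  compile : ∀ {n} → Term n → Command (2 + m)
  compile (return e)     = zero ≔ cons (onStack e) stack
  compile (bind d e)     = compile d ⨾ compile e ⨾ zero ≔ cons (hd stack) (tl (tl stack))
  compile (branch c d e) = cond (onStack c) (compile d) (compile e)
  compile (fold l i e)   =
    suc zero ≔ cons nil aux ⨾
    zero ≔ cons (onStack l) stack ⨾
    -- A right fold begins with the last entry, whereas a list yields its first; so the list is
    -- first reversed onto the second stack.
    while (hd stack) reverseBody ⨾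
    zero ≔ tl stack ⨾
    zero ≔ cons (onStack i) stack ⨾
    while (hd aux) (foldBody (compile e)) ⨾
    suc zero ≔ tl aux
  compile (call {k} e es) =
    zero ≔ pushAll es ⨾ compile e ⨾ zero ≔ cons (hd stack) (drops (suc k))

  -- The constants are the costs of the emitted tests and assignments. To depend on the term and `W`
  -- alone, `branch` is charged for both alternatives and `fold` for `W` iterations.
  steps : ∀ {n} → Term n → ℕ → ℕ
  steps (return e)     W = suc (cost (cons (onStack e) stack))
  steps (bind d e)     W = steps d W + (steps e W + 7)
  steps (branch c d e) W = suc (cost (onStack c)) + (steps d W + steps e W)
  steps (fold l i e)   W =
    4 + (suc (cost (cons (onStack l) stack)) + (W * 20 + 3 + (3 + (suc (cost (cons (onStack i) stack)) +
      (W * (24 + steps e W) + 3 + 3)))))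
  steps (call {k} e es) W =
    suc (cost (pushAll es)) + (steps e W + (4 + cost (drops (suc k))))

  push : ∀ {n} → Store n → Tree → Tree
  push []      b = b
  push (v ∷ ρ) b = v ∙ push ρ b

  private
    module _ {b q : Tree} {r : Store m} where

      lookup-stack : ∀ {n} (ρ : Store n) x →
        head (eval (push ρ b ∷ q ∷ r) (drops (index x))) ≡ Vec.lookup ρ x
      lookup-stack (v ∷ ρ) zero    = refl
      lookup-stack (v ∷ ρ) (suc x) = trans (cong head (shift (index x))) (lookup-stack ρ x)
        where
        shift : ∀ i → eval (push (v ∷ ρ) b ∷ q ∷ r) (drops (suc i)) ≡
                      eval (push ρ b ∷ q ∷ r) (drops i)
        shift zero    = refl
        shift (suc i) = cong tail (shift i)

      eval-onStack : ∀ {n} (ρ : Store n) e → eval (push ρ b ∷ q ∷ r) (onStack e) ≡ eval ρ e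
      eval-onStack ρ (var x)    = lookup-stack ρ x
      eval-onStack ρ nil        = refl
      eval-onStack ρ (cons d e) = cong₂ _∙_ (eval-onStack ρ d) (eval-onStack ρ e)
      eval-onStack ρ (hd e)     = cong head (eval-onStack ρ e)
      eval-onStack ρ (tl e)     = cong tail (eval-onStack ρ e)

      eval-pushAll : ∀ {n k} (ρ : Store n) (es : Vec (Expr n) k) →
        eval (push ρ b ∷ q ∷ r) (pushAll es) ≡ push (Vec.map (eval ρ) es) (push ρ b)
      eval-pushAll ρ []       = refl
      eval-pushAll ρ (e ∷ es) = cong₂ _∙_ (eval-onStack ρ e) (eval-pushAll ρ es)

    eval-drops : ∀ {n} (ρ : Store n) v b q r →
      eval ((v ∙ push ρ b) ∷ q ∷ r) (drops (suc n)) ≡ b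
    eval-drops ρ v b q r = go ρ v
      where
      shift : ∀ i v s → eval ((v ∙ s) ∷ q ∷ r) (drops (suc i)) ≡ eval (s ∷ q ∷ r) (drops i)
      shift zero    v s = refl
      shift (suc i) v s = cong tail (shift i v s)
      go : ∀ {n} (ρ : Store n) v → eval ((v ∙ push ρ b) ∷ q ∷ r) (drops (suc n)) ≡ b
      go []      v = refl
      go {suc n} (w ∷ ρ) v = trans (shift (suc n) v (w ∙ push ρ b)) (go ρ w)

    revOnto : Tree → Tree → Tree
    revOnto nil     a = a
    revOnto (l ∙ t) a = revOnto t (l ∙ a)

    set : ∀ {s s′ q} {r : Store m} {e T} → eval (s ∷ q ∷ r) e ≡ s′ → suc (cost e) ≤ T →
      (zero ≔ e) ⊢ s ∷ q ∷ r ⇒ s′ ∷ q ∷ r within T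
    set {e = e} refl le = weaken le (assigns zero e)

    reverse-runs : ∀ t a {s q} {r : Store m} →
      while (hd stack) reverseBody ⊢ (t ∙ s) ∷ (a ∙ q) ∷ r ⇒ (nil ∙ s) ∷ (revOnto t a ∙ q) ∷ r
        within (spine t * 20 + 3)
    reverse-runs nil     a = stop refl
    reverse-runs (l ∙ t) a = weaken (ℕ.≤-reflexive refl)
      (loop refl (assigns _ _ then assigns _ _) (reverse-runs t (l ∙ a)))

  -- The bottom `b` is arbitrary because a call runs above the environment of its caller, and `q`
  -- because the body of a fold runs while the rest of the list is stored there.
  compile-runs : ∀ {W n} {ρ : Store n} {e v} → Evaluates W ρ e v → ∀ b q (r : Store m) →
    compile e ⊢ push ρ b ∷ q ∷ r ⇒ (v ∙ push ρ b) ∷ q ∷ r within steps e W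

  private
    -- The derivation of a right fold exposes first the entry that the loop processes last. The
    -- induction therefore carries the iterations still to come as a continuation, and each entry
    -- puts one more iteration in front of it.
    fold-runs : ∀ {W n} {ρ : Store n} {z e t v} → Folds W ρ z e t v → ∀ {s b q T τ} {r : Store m} →
      while (hd aux) (foldBody (compile e)) ⊢ (v ∙ push ρ b) ∷ (s ∙ q) ∷ r ⇒ τ within T →
      while (hd aux) (foldBody (compile e)) ⊢ (z ∙ push ρ b) ∷ (revOnto t s ∙ q) ∷ r ⇒ τ
        within (spine t * (24 + steps e W) + T)
    fold-runs []      rest = rest
    fold-runs {W} {e = e} {t = l ∙ t} (d ∷ ds) {T = T} rest = weaken (ℕ.≤-reflexive eq) (fold-runs ds
      (loop refl (assigns _ _ then assigns _ _ then compile-runs d _ _ _ then assigns _ _) rest))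
      where
      identity : ∀ a c t → a * (24 + c) + (3 + (6 + (7 + (c + 8))) + t) ≡ suc a * (24 + c) + t
      identity = solve-∀
      eq : _
      eq = identity (spine t) (steps e W) T

  compile-runs (return e) b q r = set (cong (_∙ _) (eval-onStack _ e)) ℕ.≤-refl
  compile-runs (bind d e) b q r =
    compile-runs d b q r then compile-runs e b q r then set refl ℕ.≤-refl
  compile-runs {ρ = ρ} (branch-true {c = c} eq d) b q r
    with t , p , t≤ ← compile-runs d b q r =
    _ , cond-true (trans (eval-onStack ρ c) eq) p ,
    ℕ.+-monoʳ-≤ (suc (cost (onStack c))) (ℕ.≤-trans t≤ (ℕ.m≤m+n _ _))
  compile-runs {ρ = ρ} (branch-false {c = c} {d = d} eq e) b q r
    with t , p , t≤ ← compile-runs e b q r =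
    _ , cond-false (trans (eval-onStack ρ c) eq) p ,
    ℕ.+-monoʳ-≤ (suc (cost (onStack c))) (ℕ.≤-trans t≤ (ℕ.m≤n+m _ _))
  compile-runs {W} {ρ = ρ} (fold {l = l} {i} {e} {v} l≤ ds) b q r = 
    assigns _ _ then
    set (cong (_∙ _) (eval-onStack ρ l)) ℕ.≤-refl then
    weaken (ℕ.+-monoˡ-≤ 3 (ℕ.*-monoˡ-≤ 20 l≤)) (reverse-runs (eval ρ l) nil) then
    set refl ℕ.≤-refl then
    set (cong (_∙ _) (eval-onStack ρ i)) ℕ.≤-refl then
    weaken (ℕ.+-monoˡ-≤ 3 (ℕ.*-monoˡ-≤ (24 + steps e W) l≤)) (fold-runs ds (stop refl)) then
    assigns _ _
  compile-runs {W} {ρ = ρ} (call {k = k} {e = e} {es = es} {v} d) b q r =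
    set (eval-pushAll ρ es) ℕ.≤-refl then
    compile-runs d (push ρ b) q r then
    set (cong (v ∙_) (eval-drops (Vec.map (eval ρ) es) v (push ρ b) q r)) ℕ.≤-refl

-- Running a program beside a variable that it leaves alone

reserveExpr : ∀ {k} → Expr (suc k) → Expr (2 + k)
reserveExpr (var x)    = var (punchIn (suc zero) x)
reserveExpr nil        = nil
reserveExpr (cons d e) = cons (reserveExpr d) (reserveExpr e)
reserveExpr (hd e)     = hd (reserveExpr e)
reserveExpr (tl e)     = tl (reserveExpr e)

-- Variable zero stays the input and output, while variable one is skipped: it remembers the number
-- of cliques during the run of the given program.
reserve : ∀ {k} → Command (suc k) → Command (2 + k)
reserve (x ≔ e)      = punchIn (suc zero) x ≔ reserveExpr e
reserve (C ⨾ D)      = reserve C ⨾ reserve D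
reserve (cond e C D) = cond (reserveExpr e) (reserve C) (reserve D)
reserve (while e C)  = while (reserveExpr e) (reserve C)

cost-reserve : ∀ {k} (e : Expr (suc k)) → cost (reserveExpr e) ≡ cost e
cost-reserve (var x)    = refl
cost-reserve nil        = refl
cost-reserve (cons d e) = cong₂ (λ a b → suc (a + b)) (cost-reserve d) (cost-reserve e)
cost-reserve (hd e)     = cong suc (cost-reserve e)
cost-reserve (tl e)     = cong suc (cost-reserve e)

module _ (s : Tree) where

  withReserved : ∀ {k} → Store (suc k) → Store (2 + k)
  withReserved (v ∷ σ) = v ∷ s ∷ σ

  eval-reserve : ∀ {k} (σ : Store (suc k)) e → eval (withReserved σ) (reserveExpr e) ≡ eval σ e
  eval-reserve (v ∷ σ) (var zero)    = refl
  eval-reserve (v ∷ σ) (var (suc x)) = refl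
  eval-reserve σ nil        = refl
  eval-reserve σ (cons d e) = cong₂ _∙_ (eval-reserve σ d) (eval-reserve σ e)
  eval-reserve σ (hd e)     = cong head (eval-reserve σ e)
  eval-reserve σ (tl e)     = cong tail (eval-reserve σ e)

  update-reserved : ∀ {k} (σ : Store (suc k)) x v →
    withReserved σ Vec.[ punchIn (suc zero) x ]≔ v ≡ withReserved (σ Vec.[ x ]≔ v)
  update-reserved (w ∷ σ) zero    v = refl
  update-reserved (w ∷ σ) (suc x) v = refl

  reserve-runs : ∀ {k} {C : Command (suc k)} {σ τ t} → C ⊢ σ ⇒ τ [ t ] →
    reserve C ⊢ withReserved σ ⇒ withReserved τ [ t ]
  reserve-runs {σ = σ} (assign x e)
    rewrite sym (update-reserved σ x (eval σ e)) | sym (eval-reserve σ e) | sym (cost-reserve e) =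
    assign _ _
  reserve-runs (sequence p q) = sequence (reserve-runs p) (reserve-runs q)
  reserve-runs {σ = σ} (cond-true {e = e} eq p) rewrite sym (cost-reserve e) =
    cond-true (trans (eval-reserve σ e) eq) (reserve-runs p)
  reserve-runs {σ = σ} (cond-false {e = e} eq p) rewrite sym (cost-reserve e) =
    cond-false (trans (eval-reserve σ e) eq) (reserve-runs p)
  reserve-runs {σ = σ} (while-true {e = e} eq p q) rewrite sym (cost-reserve e) =
    while-true (trans (eval-reserve σ e) eq) (reserve-runs p) (reserve-runs q)
  reserve-runs {σ = σ} (while-false {e = e} eq) rewrite sym (cost-reserve e) =
    while-false (trans (eval-reserve σ e) eq)

-- Polynomial time bounds

-- `W` is nonzero so that `W ^ d` is monotone in `d`, on which the bound for sums relies.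
PolynomiallyBounded : (ℕ → ℕ) → Set
PolynomiallyBounded f = ∃[ K ] ∃[ d ] ∀ W → .{{NonZero W}} → f W ≤ K * W ^ d

constant-bounded : ∀ c → PolynomiallyBounded (λ _ → c)
constant-bounded c = c , 0 , λ W → ℕ.≤-reflexive (sym (ℕ.*-identityʳ c))

+-bounded : ∀ {f g} → PolynomiallyBounded f → PolynomiallyBounded g →
  PolynomiallyBounded (λ W → f W + g W)
+-bounded {f} {g} (K , d , f≤) (L , e , g≤) = K + L , d + e , λ W → begin
  f W + g W                         ≤⟨ ℕ.+-mono-≤ (f≤ W) (g≤ W) ⟩
  K * W ^ d + L * W ^ e             ≤⟨ ℕ.+-mono-≤
    (ℕ.*-monoʳ-≤ K (ℕ.^-monoʳ-≤ W (ℕ.m≤m+n d e)))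
    (ℕ.*-monoʳ-≤ L (ℕ.^-monoʳ-≤ W (ℕ.m≤n+m e d))) ⟩
  K * W ^ (d + e) + L * W ^ (d + e) ≡⟨ ℕ.*-distribʳ-+ (W ^ (d + e)) K L ⟨
  (K + L) * W ^ (d + e)             ∎
  where open ℕ.≤-Reasoning

W*-bounded : ∀ {f} → PolynomiallyBounded f → PolynomiallyBounded (λ W → W * f W)
W*-bounded {f} (K , d , f≤) = K , suc d , λ W → begin
  W * f W         ≤⟨ ℕ.*-monoʳ-≤ W (f≤ W) ⟩
  W * (K * W ^ d) ≡⟨ x∙yz≈y∙xz W K (W ^ d) ⟩
  K * (W * W ^ d) ∎
  where
  open ℕ.≤-Reasoning
  open CommutativeSemigroup ℕ.*-commutativeSemigroup using (x∙yz≈y∙xz)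

steps-bounded : ∀ {m n} (e : Term n) → PolynomiallyBounded (steps {m} e)
steps-bounded (return e)     = constant-bounded _
steps-bounded (bind d e)     =
  +-bounded (steps-bounded d) (+-bounded (steps-bounded e) (constant-bounded _))
steps-bounded {m} (branch c d e) =
  +-bounded (constant-bounded (suc (cost (onStack {m} c)))) (+-bounded (steps-bounded d) (steps-bounded e))
steps-bounded {m} (fold l i e)   =
  +-bounded (constant-bounded 4) (+-bounded (constant-bounded (suc (cost (cons (onStack {m} l) stack))))
  (+-bounded (+-bounded (W*-bounded (constant-bounded 20)) (constant-bounded 3))
  (+-bounded (constant-bounded 3) (+-bounded (constant-bounded (suc (cost (cons (onStack {m} i) stack))))
  (+-bounded (+-bounded (W*-bounded (+-bounded (constant-bounded 24) (steps-bounded e)))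
     (constant-bounded 3)) (constant-bounded 3))))))
steps-bounded {m} (call {k} e es) =
  +-bounded (constant-bounded (suc (cost (pushAll {m} es))))
    (+-bounded (steps-bounded e) (constant-bounded (4 + cost (drops {m} (suc k)))))

-- The reduction as a program

-- Dropping the bound on variables makes the reduction uniform in `N`; the encoding of a formula
-- does not change.
RawClause : Set
RawClause = List (Bool × ℕ)

-- Positions past the end read as `false`, in agreement with `head` and `tail`, which send `nil` to
-- `nil`.
bit : List Bool → ℕ → Bool
bit []      _       = false
bit (b ∷ y) zero    = b
bit (b ∷ y) (suc i) = bit y i

-- Carrying the distance to the diagonal lets the program recognise the end of a row by a test for
-- `nil`, without a comparison.
next : ℕ × ℕ × ℕ → ℕ × ℕ × ℕ
next (i , j , zero)  = suc i , zero , suc i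
next (i , j , suc d) = i , suc j , d

-- The pairs (i , j) with j ≤ i in lexicographic order, with i ∸ j as a
-- third component.

triangular : ℕ → ℕ × ℕ × ℕ
triangular zero    = 0 , 0 , 0
triangular (suc x) = next (triangular x)

row column : ℕ → ℕ
row    = proj₁ ∘ triangular
column = proj₁ ∘ proj₂ ∘ triangular

bitVectors : ℕ → List (List Bool)
bitVectors zero    = [] ∷ []
bitVectors (suc k) = foldr (λ y ys → (true ∷ y) ∷ (false ∷ y) ∷ ys) [] (bitVectors k)

tautology : ℕ → RawClause
tautology x = (true , x) ∷ (false , x) ∷ []

addTautologies : ℕ → List RawClause → List RawClause
addTautologies zero    cs = cs
addTautologies (suc N) cs = tautology N ∷ addTautologies N cs

-- Each entry is numbered by the length of the list behind it, which is what a right fold can count.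
-- For this reason group numbers descend along the list of vertices.
number : ∀ {A : Set} → List A → List (ℕ × A)
number []       = []
number (x ∷ xs) = (length xs , x) ∷ number xs

Label : Set
Label = ℕ × ℕ × List Bool

-- The first component is a serial number. It keeps apart vertices with equal labels, which arise
-- when two literals of a clause lie in the same row.
Vertex : Set
Vertex = ℕ × Label

literalLabels : List (List Bool) → ℕ → Bool × ℕ → List Label
literalLabels ys g (p , x) =
  concatMap (λ y → if bit y (column x) xor p then [] else (g , row x , y) ∷ []) ys

labels : List (List Bool) → List (ℕ × RawClause) → List Label
labels ys = concatMap (λ (g , c) → concatMap (literalLabels ys g) c)

adjacent : Vertex → Vertex → Bool
adjacent (s , g , i , y) (t , h , j , z) =
  if s ≡ᵇ t then false else if g ≡ᵇ h then true else bit y j xor bit z i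

encodePair : ∀ {A B : Set} → (A → Tree) → (B → Tree) → A × B → Tree
encodePair f g (x , y) = f x ∙ g y

encodeBits : List Bool → Tree
encodeBits = encodeList encodeBool

encodeRawClause : RawClause → Tree
encodeRawClause = encodeList (encodePair encodeBool encodeℕ)

encodeLabel : Label → Tree
encodeLabel = encodePair encodeℕ (encodePair encodeℕ encodeBits)

encodeVertex : Vertex → Tree
encodeVertex = encodePair encodeℕ encodeLabel

encodeTriple : ℕ × ℕ × ℕ → Tree
encodeTriple = encodePair encodeℕ (encodePair encodeℕ encodeℕ)

spine-encodeℕ : ∀ n → spine (encodeℕ n) ≡ n
spine-encodeℕ zero    = refl
spine-encodeℕ (suc n) = cong suc (spine-encodeℕ n)

spine-encodeList : ∀ {A : Set} (f : A → Tree) xs → spine (encodeList f xs) ≡ length xs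
spine-encodeList f []       = refl
spine-encodeList f (x ∷ xs) = cong suc (spine-encodeList f xs)

v0 : ∀ {n} → Expr (1 + n)
v0 = var zero
v1 : ∀ {n} → Expr (2 + n)
v1 = var (suc zero)
v2 : ∀ {n} → Expr (3 + n)
v2 = var (suc (suc zero))
v3 : ∀ {n} → Expr (4 + n)
v3 = var (suc (suc (suc zero)))
v4 : ∀ {n} → Expr (5 + n)
v4 = var (suc (suc (suc (suc zero))))
v5 : ∀ {n} → Expr (6 + n)
v5 = var (suc (suc (suc (suc (suc zero)))))
v6 : ∀ {n} → Expr (7 + n)
v6 = var (suc (suc (suc (suc (suc (suc zero))))))
v7 : ∀ {n} → Expr (8 + n)
v7 = var (suc (suc (suc (suc (suc (suc (suc zero)))))))

successor : ∀ {n} → Expr n → Expr n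
successor = cons nil

trueExpr falseExpr : ∀ {n} → Expr n
trueExpr  = cons nil nil
falseExpr = nil

bitTerm subtractTerm xorTerm equalTerm adjacentTerm rowTerm labelsTerm : Term 2
numberTerm matrixTerm tautologiesTerm triangularTerm bitVectorsTerm reductionTerm answerTerm : Term 1

bitTerm = bind (fold v0 v1 (return (tl v1))) (return (hd v0))

-- suc n ∸ m is nonzero iff m ≤ n.

subtractTerm = fold v0 (successor v1) (return (tl v1))

xorTerm = branch v0 (branch v1 (return falseExpr) (return trueExpr)) (return v1)

equalTerm =
  bind (call subtractTerm (v0 ∷ v1 ∷ []))
  (bind (call subtractTerm (v2 ∷ v1 ∷ []))
  (branch v1 (branch v0 (return trueExpr) (return falseExpr)) (return falseExpr)))

adjacentTerm =
  bind (call equalTerm (hd v0 ∷ hd v1 ∷ []))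
  (branch v0 (return falseExpr)
  (bind (call equalTerm (hd (tl v1) ∷ hd (tl v2) ∷ []))
  (branch v0 (return trueExpr)
  (bind (call bitTerm (hd (tl (tl v3)) ∷ tl (tl (tl v2)) ∷ []))
  (bind (call bitTerm (hd (tl (tl v3)) ∷ tl (tl (tl v4)) ∷ []))
  (call xorTerm (v1 ∷ v0 ∷ [])))))))

rowTerm = fold v1 nil
  (bind (call adjacentTerm (v2 ∷ v0 ∷ [])) (return (cons v0 v2)))

matrixTerm = fold v0 nil
  (bind (call rowTerm (v0 ∷ v2 ∷ [])) (return (cons v0 v2)))

numberTerm = fold v0 (cons nil nil)
  (return (cons (successor (hd v1)) (cons (cons (hd v1) v0) (tl v1))))

tautologiesTerm = fold (hd v0) (cons nil (tl v0))
  (return (cons (successor (hd v1)) (cons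
    (cons (cons trueExpr (hd v1)) (cons (cons falseExpr (hd v1)) nil))
    (tl v1))))

triangularTerm = fold v0 (cons nil (cons nil nil))
  (branch (tl (tl v1))
    (return (cons (hd v1) (cons (successor (hd (tl v1))) (tl (tl (tl v1))))))
    (return (cons (successor (hd v1)) (cons nil (successor (hd v1))))))

bitVectorsTerm = fold v0 (cons nil nil)
  (fold v1 nil (return (cons (cons trueExpr v0) (cons (cons falseExpr v0) v1))))

labelsTerm =
  fold v0 nil
  -- Each inner fold starts from the accumulator of the enclosing one, so that concatenation needs
  -- no pass of its own.
  (fold (tl v0) v1
  (bind (call triangularTerm (tl v0 ∷ []))
  (fold v6 v2
  (bind (call bitTerm (hd (tl v2) ∷ v0 ∷ []))
  (bind (call xorTerm (v0 ∷ hd v4 ∷ []))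
  (branch v0 (return v3) (return (cons (cons (hd v7) (cons (hd v4) v2)) v3))))))))

reductionTerm =
  bind (call tautologiesTerm (v0 ∷ []))
  (bind (call numberTerm (tl v0 ∷ []))
  (bind (call triangularTerm (hd v2 ∷ []))
  (bind (call bitVectorsTerm (successor (hd v0) ∷ []))
  (bind (call labelsTerm (tl v2 ∷ v0 ∷ []))
  (bind (call numberTerm (v0 ∷ []))
  (bind (call matrixTerm (tl v0 ∷ []))
  -- `hd v5` is the number of cliques, which `numberTerm` returned along with the numbered clauses.
  (return (cons v0 (hd v5)))))))))

answerTerm =
  bind (fold (hd v0) nil (branch v0 (return (successor v1)) (return v1)))
  (bind (call subtractTerm (tl v1 ∷ v0 ∷ []))
  (branch v0 (return trueExpr) (return falseExpr)))

length-number : ∀ {A : Set} (xs : List A) → length (number xs) ≡ length xs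
length-number []       = refl
length-number (x ∷ xs) = cong suc (length-number xs)

groups : ℕ → List RawClause → List (ℕ × RawClause)
groups N cs = number (addTautologies N cs)

length-addTautologies : ∀ N cs → length (addTautologies N cs) ≡ N + length cs
length-addTautologies zero    cs = refl
length-addTautologies (suc N) cs = cong suc (length-addTautologies N cs)

length-bitVectors : ∀ k → length (bitVectors k) ≡ 2 ^ k
length-bitVectors zero    = refl
length-bitVectors (suc k) = trans (double (bitVectors k)) (cong (2 *_) (length-bitVectors k))
  where
  double : ∀ ys → length (foldr (λ y ys → (true ∷ y) ∷ (false ∷ y) ∷ ys) [] ys) ≡ 2 * length ys
  double []       = refl
  double (y ∷ ys) = trans (cong (λ n → suc (suc n)) (double ys)) (sym (ℕ.*-suc 2 (length ys)))

encodeMatrix : List (List Bool) → Tree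
encodeMatrix = encodeList encodeBits

-- Correctness of the terms

module _ {W : ℕ} where

  returns : ∀ {n} {ρ : Store n} {e v} → eval ρ e ≡ v → Evaluates W ρ (return e) v
  returns refl = return _

  branches : ∀ {A : Set} {n} {ρ : Store n} {c d e x y} (enc : A → Tree) b →
    eval ρ c ≡ encodeBool b → Evaluates W ρ d (enc x) → Evaluates W ρ e (enc y) →
    Evaluates W ρ (branch c d e) (enc (if b then x else y))
  branches enc true  eq d e = branch-true eq d
  branches enc false eq d e = branch-false eq e

  folds-list : ∀ {A : Set} {n} {ρ : Store n} {e f} (F : List A → Tree) xs →
    (∀ x xs → Evaluates W (f x ∷ F xs ∷ ρ) e (F (x ∷ xs))) →
    Folds W ρ (F []) e (encodeList f xs) (F xs)
  folds-list F []       step = []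
  folds-list F (x ∷ xs) step = step x xs ∷ folds-list F xs step

  folds-map : ∀ {A B : Set} {n} {ρ : Store n} {e encA encB} {h : A → B} xs →
    (∀ {x} → x ∈ xs → ∀ r → Evaluates W (encA x ∷ r ∷ ρ) e (encB (h x) ∙ r)) →
    Folds W ρ nil e (encodeList encA xs) (encodeList encB (map h xs))
  folds-map []       step = []
  folds-map (x ∷ xs) step = step (here refl) _ ∷ folds-map xs (step ∘ there)

  folds-concatMap : ∀ {A B : Set} {n} {ρ : Store n} {e encA encB} {f : A → List B} {zs} xs →
    (∀ {x} → x ∈ xs → ∀ r →
      Evaluates W (encA x ∷ encodeList encB r ∷ ρ) e (encodeList encB (f x ++ r))) →
    Folds W ρ (encodeList encB zs) e (encodeList encA xs) (encodeList encB (concatMap f xs ++ zs))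
  folds-concatMap []       step = []
  folds-concatMap {encB = encB} {f} {zs} (x ∷ xs) step =
    subst (Evaluates W _ _) (cong (encodeList encB) (sym (++-assoc (f x) (concatMap f xs) zs)))
      (step (here refl) (concatMap f xs ++ zs)) ∷ folds-concatMap xs (step ∘ there)

  folds-ℕ : ∀ {n} {ρ : Store n} {e} (F : ℕ → Tree) k →
    (∀ {i} → i < k → Evaluates W (nil ∷ F i ∷ ρ) e (F (suc i))) →
    Folds W ρ (F 0) e (encodeℕ k) (F k)
  folds-ℕ F zero    step = []
  folds-ℕ F (suc k) step = step ℕ.≤-refl ∷ folds-ℕ F k (step ∘ ℕ.m≤n⇒m≤1+n)

  fold-ℕ : ∀ {n} {ρ : Store n} {l i e v k} → eval ρ l ≡ encodeℕ k → k ≤ W →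
    Folds W ρ (eval ρ i) e (encodeℕ k) v → Evaluates W ρ (fold l i e) v
  fold-ℕ {k = k} eq k≤W ds =
    fold (subst (λ t → spine t ≤ W) (sym eq) (subst (_≤ W) (sym (spine-encodeℕ k)) k≤W))
         (subst (λ t → Folds W _ _ _ t _) (sym eq) ds)

  fold-list : ∀ {A : Set} {n} {ρ : Store n} {l i e v} {f : A → Tree} xs →
    eval ρ l ≡ encodeList f xs → length xs ≤ W →
    Folds W ρ (eval ρ i) e (encodeList f xs) v → Evaluates W ρ (fold l i e) v
  fold-list {f = f} xs eq ≤W ds =
    fold (subst (λ t → spine t ≤ W) (sym eq) (subst (_≤ W) (sym (spine-encodeList f xs)) ≤W))
         (subst (λ t → Folds W _ _ _ t _) (sym eq) ds)

  private
    tails : Tree → ℕ → Tree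
    tails t zero    = t
    tails t (suc i) = tail (tails t i)

    tails-∙ : ∀ l r i → tails (l ∙ r) (suc i) ≡ tails r i
    tails-∙ l r zero    = refl
    tails-∙ l r (suc i) = cong tail (tails-∙ l r i)

    tails-nil : ∀ i → tails nil i ≡ nil
    tails-nil zero    = refl
    tails-nil (suc i) = cong tail (tails-nil i)

    head-tails : ∀ y i → head (tails (encodeBits y) i) ≡ encodeBool (bit y i)
    head-tails []      i       = cong head (tails-nil i)
    head-tails (b ∷ y) zero    = refl
    head-tails (b ∷ y) (suc i) = trans (cong head (tails-∙ _ _ i)) (head-tails y i)

    tails-ℕ : ∀ n i → tails (encodeℕ n) i ≡ encodeℕ (n ∸ i)
    tails-ℕ n       zero    = refl
    tails-ℕ zero    (suc i) = tails-nil (suc i)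
    tails-ℕ (suc n) (suc i) = trans (tails-∙ _ _ i) (tails-ℕ n i)

  bit-evaluates : ∀ {i y} → i ≤ W →
    Evaluates W (encodeℕ i ∷ encodeBits y ∷ []) bitTerm (encodeBool (bit y i))
  bit-evaluates {i} {y} i≤ =
    bind (fold-ℕ refl i≤ (folds-ℕ (tails (encodeBits y)) i (λ _ → return _)))
         (returns (head-tails y i))

  subtract-evaluates : ∀ {m n} → m ≤ W →
    Evaluates W (encodeℕ m ∷ encodeℕ n ∷ []) subtractTerm (encodeℕ (suc n ∸ m))
  subtract-evaluates {m} {n} m≤ =
    fold-ℕ refl m≤ (subst (Folds W _ _ _ _) (tails-ℕ (suc n) m)
      (folds-ℕ (tails (encodeℕ (suc n))) m (λ _ → return _)))

  xor-evaluates : ∀ a b →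
    Evaluates W (encodeBool a ∷ encodeBool b ∷ []) xorTerm (encodeBool (a xor b))
  xor-evaluates false b     = branch-false refl (return _)
  xor-evaluates true  false = branch-true refl (branch-false refl (return _))
  xor-evaluates true  true  = branch-true refl (branch-true refl (return _))

  equal-evaluates : ∀ {m n} → m ≤ W → n ≤ W →
    Evaluates W (encodeℕ m ∷ encodeℕ n ∷ []) equalTerm (encodeBool (m ≡ᵇ n))
  equal-evaluates {m} {n} m≤ n≤ =
    bind (call (subtract-evaluates m≤)) (bind (call (subtract-evaluates n≤)) (cases m n))
    where
    cases : ∀ m n {k} {ρ : Store k} →
      Evaluates W (encodeℕ (suc m ∸ n) ∷ encodeℕ (suc n ∸ m) ∷ ρ)
        (branch v1 (branch v0 (return trueExpr) (return falseExpr)) (return falseExpr))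
        (encodeBool (m ≡ᵇ n))
    cases zero    zero    = branch-true refl (branch-true refl (return _))
    cases zero    (suc n) rewrite ℕ.0∸n≡0 n =
      branch-true refl (branch-false refl (return _))
    cases (suc m) zero    rewrite ℕ.0∸n≡0 m = branch-false refl (return _)
    cases (suc m) (suc n) = cases m n

  Bounded : Vertex → Set
  Bounded (s , g , i , y) = s ≤ W × g ≤ W × i ≤ W

  adjacent-evaluates : ∀ u v → Bounded u → Bounded v →
    Evaluates W (encodeVertex u ∷ encodeVertex v ∷ []) adjacentTerm (encodeBool (adjacent u v))
  adjacent-evaluates (s , g , i , y) (t , h , j , z) (s≤ , g≤ , i≤) (t≤ , h≤ , j≤) =
    bind (call (equal-evaluates s≤ t≤))
    (branches encodeBool (s ≡ᵇ t) refl (return _)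
    (bind (call (equal-evaluates g≤ h≤))
    (branches encodeBool (g ≡ᵇ h) refl (return _)
    (bind (call (bit-evaluates {y = y} j≤)) (bind (call (bit-evaluates {y = z} i≤))
    (call (xor-evaluates (bit y j) (bit z i))))))))

  matrix-evaluates : ∀ vs → length vs ≤ W → All Bounded vs →
    Evaluates W (encodeList encodeVertex vs ∷ []) matrixTerm
      (encodeMatrix (map (λ u → map (adjacent u) vs) vs))
  matrix-evaluates vs len bounded = fold-list vs refl len (folds-map vs λ {u} u∈ r →
    bind (call (fold-list vs refl len (folds-map vs λ {v} v∈ r →
      bind (call (adjacent-evaluates u v (All.lookup bounded u∈) (All.lookup bounded v∈))) (return _))))
    (return _))

  number-evaluates : ∀ {A : Set} {f : A → Tree} xs → length xs ≤ W →
    Evaluates W (encodeList f xs ∷ []) numberTerm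
      (encodeℕ (length xs) ∙ encodeList (encodePair encodeℕ f) (number xs))
  number-evaluates {f = f} xs len = fold-list xs refl len (folds-list
    (λ xs → encodeℕ (length xs) ∙ encodeList (encodePair encodeℕ f) (number xs)) xs
    (λ _ _ → return _))

  tautologies-evaluates : ∀ {N cs} → N ≤ W →
    Evaluates W ((encodeℕ N ∙ encodeList encodeRawClause cs) ∷ []) tautologiesTerm
      (encodeℕ N ∙ encodeList encodeRawClause (addTautologies N cs))
  tautologies-evaluates {N} {cs} N≤ = fold-ℕ refl N≤
    (folds-ℕ (λ i → encodeℕ i ∙ encodeList encodeRawClause (addTautologies i cs)) N (λ _ → return _))

  triangular-evaluates : ∀ {x} → x ≤ W →
    Evaluates W (encodeℕ x ∷ []) triangularTerm (encodeTriple (triangular x))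
  triangular-evaluates {x} x≤ = fold-ℕ refl x≤
    (folds-ℕ (encodeTriple ∘ triangular) x (λ {i} _ → step (triangular i)))
    where
    step : ∀ p → Evaluates W (nil ∷ encodeTriple p ∷ _) _ (encodeTriple (next p))
    step (i , j , zero)  = branch-false refl (return _)
    step (i , j , suc d) = branch-true refl (return _)

  bitVectors-evaluates : ∀ {k} → k ≤ W → 2 ^ k ≤ W →
    Evaluates W (encodeℕ k ∷ []) bitVectorsTerm (encodeMatrix (bitVectors k))
  bitVectors-evaluates {k} k≤ 2^k≤ = fold-ℕ refl k≤
    (folds-ℕ (encodeMatrix ∘ bitVectors) k (λ {i} i<k →
      fold-list (bitVectors i) refl
        (subst (_≤ W) (sym (length-bitVectors i)) (ℕ.≤-trans (ℕ.^-monoʳ-≤ 2 (ℕ.<⇒≤ i<k)) 2^k≤))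
        (folds-list (encodeMatrix ∘ foldr (λ y ys → (true ∷ y) ∷ (false ∷ y) ∷ ys) [])
          (bitVectors i) (λ _ _ → return _))))

  labels-evaluates : ∀ ys gs → length ys ≤ W → length gs ≤ W →
    All (λ (g , c) → length c ≤ W × All (λ (p , x) → x ≤ W × column x ≤ W) c) gs →
    Evaluates W (encodeList (encodePair encodeℕ encodeRawClause) gs ∷ encodeMatrix ys ∷ []) labelsTerm
      (encodeList encodeLabel (labels ys gs))
  labels-evaluates ys gs ys≤ gs≤ bounds =
    subst (Evaluates W _ _) (cong (encodeList encodeLabel) (++-identityʳ (labels ys gs)))
    (fold-list gs refl gs≤ (folds-concatMap gs λ {(g , c)} gc∈ r →
      let c≤ , bounds′ = All.lookup bounds gc∈ in
      fold-list c refl c≤ (folds-concatMap c λ {(p , x)} px∈ r →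
        let x≤ , j≤ = All.lookup bounds′ px∈ in
        bind (call (triangular-evaluates x≤))
        (fold-list ys refl ys≤ (folds-concatMap ys λ {y} y∈ r →
          bind (call (bit-evaluates {y = y} j≤)) (bind (call (xor-evaluates (bit y (column x)) p))
          (subst (Evaluates W _ _) (sym (if-float (λ vs → encodeList encodeLabel (vs ++ r))
            (bit y (column x) xor p)))
            (branches (λ t → t) (bit y (column x) xor p) refl (return _) (return _)))))))))

  answer-evaluates : ∀ {n} (S : Subset n) k → n ≤ W → k ≤ W →
    Evaluates W ((encodeSubset S ∙ encodeℕ k) ∷ []) answerTerm (encodeBool (does (k ≤? ∣ S ∣)))
  answer-evaluates S k n≤ k≤ =
    bind (fold (subst (_≤ W) (sym (spine-encodeVec S)) n≤) (counts S))
    (bind (call (subtract-evaluates k≤)) (cases k ∣ S ∣))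
    where
    spine-encodeVec : ∀ {n} (S : Subset n) → spine (encodeSubset S) ≡ n
    spine-encodeVec []      = refl
    spine-encodeVec (b ∷ S) = cong suc (spine-encodeVec S)
    counts : ∀ {n m} {ρ : Store m} (S : Subset n) →
      Folds W ρ nil (branch v0 (return (successor v1)) (return v1)) (encodeSubset S) (encodeℕ ∣ S ∣)
    counts []          = []
    counts (false ∷ S) = branch-false refl (return _) ∷ counts S
    counts (true ∷ S)  = branch-true refl (return _) ∷ counts S
    cases : ∀ k n {m} {ρ : Store m} → Evaluates W (encodeℕ (suc n ∸ k) ∷ ρ)
      (branch v0 (return trueExpr) (return falseExpr)) (encodeBool (does (k ≤? n)))
    cases zero    n       = branch-true refl (return _)
    cases (suc k) zero    rewrite ℕ.0∸n≡0 k = branch-false refl (return _)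
    cases (suc zero) (suc n) = branch-true refl (return _)
    cases (suc (suc k)) (suc n) = cases (suc k) n

  reduction-evaluates : ∀ N cs {ls} → labels (bitVectors (suc (row N))) (groups N cs) ≡ ls →
    let vs = number ls in N ≤ W → suc (row N) ≤ W → 2 ^ suc (row N) ≤ W →
    length (addTautologies N cs) ≤ W → length vs ≤ W →
    All (λ (g , c) → length c ≤ W × All (λ (p , x) → x ≤ W × column x ≤ W) c) (groups N cs) →
    All Bounded vs →
    Evaluates W ((encodeℕ N ∙ encodeList encodeRawClause cs) ∷ []) reductionTerm
      (encodeMatrix (map (λ u → map (adjacent u) vs) vs) ∙ encodeℕ (length (addTautologies N cs)))
  reduction-evaluates N cs {ls} refl N≤ k≤ 2^k≤ gs≤ vs≤ bounds bounded =
    bind (call (tautologies-evaluates {cs = cs} N≤))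
    (bind (call (number-evaluates (addTautologies N cs) gs≤))
    (bind (call (triangular-evaluates N≤))
    (bind (call (bitVectors-evaluates k≤ 2^k≤))
    (bind (call (labels-evaluates (bitVectors (suc (row N))) (groups N cs)
      (subst (_≤ W) (sym (length-bitVectors (suc (row N)))) 2^k≤)
      (subst (_≤ W) (sym (length-number (addTautologies N cs))) gs≤) bounds))
    (bind (call (number-evaluates ls (subst (_≤ W) (length-number ls) vs≤)))
    (bind (call (matrix-evaluates (number ls) vs≤ bounded))
    (return _)))))))

-- Independent sets and satisfying assignments

≡ᵇ-refl : ∀ n → (n ≡ᵇ n) ≡ true
≡ᵇ-refl zero    = refl
≡ᵇ-refl (suc n) = ≡ᵇ-refl n

≡ᵇ-sym : ∀ m n → (m ≡ᵇ n) ≡ (n ≡ᵇ m)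
≡ᵇ-sym zero    zero    = refl
≡ᵇ-sym zero    (suc n) = refl
≡ᵇ-sym (suc m) zero    = refl
≡ᵇ-sym (suc m) (suc n) = ≡ᵇ-sym m n

≡ᵇ-sound : ∀ {m n} → (m ≡ᵇ n) ≡ true → m ≡ n
≡ᵇ-sound {m} {n} eq = ℕ.≡ᵇ⇒≡ m n (subst T (sym eq) _)

≡ᵇ-complete : ∀ {m n} → (m ≡ᵇ n) ≡ false → m ≢ n
≡ᵇ-complete {m} eq refl = contradiction (trans (sym (≡ᵇ-refl m)) eq) λ ()

xor-false : ∀ {a b} → a xor b ≡ false → a ≡ b
xor-false {false} {false} refl = refl
xor-false {true}  {true}  refl = refl

adjacent-sym : ∀ u v → adjacent u v ≡ adjacent v u
adjacent-sym (s , g , i , y) (t , h , j , z)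
  rewrite ≡ᵇ-sym s t | ≡ᵇ-sym g h | xor-comm (bit y j) (bit z i) = refl

adjacent-irrefl : ∀ u → adjacent u u ≡ false
adjacent-irrefl (s , _) rewrite ≡ᵇ-refl s = refl

tag group : Vertex → ℕ
tag   = proj₁
group = proj₁ ∘ proj₂

-- crossing u v xor crossing v u is the value of the symplectic form on
-- 𝔽₂ᵏ × 𝔽₂ᵏ at (e i , y) and (e j , z).

crossing : Vertex → Vertex → Bool
crossing (_ , _ , _ , y) (_ , _ , j , _) = bit y j

nonadjacent⁻ : ∀ u v → adjacent u v ≡ false →
  tag u ≡ tag v ⊎ (group u ≢ group v × crossing u v ≡ crossing v u)
nonadjacent⁻ (s , g , i , y) (t , h , j , z) eq with s ≡ᵇ t in s≟t | g ≡ᵇ h in g≟h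
... | true  | _     = inj₁ (≡ᵇ-sound s≟t)
... | false | false = inj₂ (≡ᵇ-complete g≟h , xor-false eq)

nonadjacent⁺ : ∀ u v → group u ≢ group v → crossing u v ≡ crossing v u → adjacent u v ≡ false
nonadjacent⁺ (s , g , i , y) (t , h , j , z) g≢h eq with s ≡ᵇ t | g ≡ᵇ h in g≟h
... | true  | _     = refl
... | false | true  = contradiction (≡ᵇ-sound g≟h) g≢h
... | false | false rewrite eq = xor-same (bit z i)

graph : (vs : List Vertex) → Graph (length vs)
graph vs = record
  { edge   = λ u v → adjacent (lookup vs u) (lookup vs v)
  ; symm   = λ u v → adjacent-sym (lookup vs u) (lookup vs v)
  ; irrefl = λ v → adjacent-irrefl (lookup vs v)
  }

encodeVec-tabulate-lookup : ∀ {A B : Set} {enc : B → Tree} (h : A → B) xs →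
  encodeVec enc (tabulate (h ∘ lookup xs)) ≡ encodeList enc (map h xs)
encodeVec-tabulate-lookup h []       = refl
encodeVec-tabulate-lookup h (x ∷ xs) = cong (_ ∙_) (encodeVec-tabulate-lookup h xs)

encodeVec-cong : ∀ {A B : Set} {f : A → Tree} {g : B → Tree} {n} {x : Fin n → A} {y : Fin n → B} →
  (∀ i → f (x i) ≡ g (y i)) → encodeVec f (tabulate x) ≡ encodeVec g (tabulate y)
encodeVec-cong {n = zero}  eq = refl
encodeVec-cong {n = suc n} eq = cong₂ _∙_ (eq zero) (encodeVec-cong (eq ∘ suc))

encodeGraph-graph : ∀ vs →
  encodeGraph (graph vs) ≡ encodeMatrix (map (λ u → map (adjacent u) vs) vs)
encodeGraph-graph vs = trans
  (encodeVec-cong {g = encodeBits} λ u → encodeVec-tabulate-lookup (adjacent (lookup vs u)) vs)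
  (encodeVec-tabulate-lookup (λ u → map (adjacent u) vs) vs)

module _ {A : Set} where

  number-position : ∀ (xs : List A) u → proj₁ (lookup (number xs) u) + suc (toℕ u) ≡ length xs
  number-position (x ∷ xs) zero    = ℕ.+-comm (length xs) 1
  number-position (x ∷ xs) (suc u) = trans (ℕ.+-suc _ _) (cong suc (number-position xs u))

  number-injective : ∀ (xs : List A) {u v} →
    proj₁ (lookup (number xs) u) ≡ proj₁ (lookup (number xs) v) → u ≡ v
  number-injective xs {u} {v} eq = Fin.toℕ-injective (ℕ.suc-injective (ℕ.+-cancelˡ-≡ _ _ _
    (trans (number-position xs u) (trans (sym (number-position xs v)) (cong (_+ _) (sym eq))))))

  number-< : ∀ {xs : List A} {g x} → (g , x) ∈ number xs → g < length xs
  number-< {x ∷ xs} (here refl) = ℕ.≤-refl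
  number-< {x ∷ xs} (there ∈xs) = ℕ.m≤n⇒m≤1+n (number-< ∈xs)

  number-∈ : ∀ {xs : List A} {g x} → (g , x) ∈ number xs → x ∈ xs
  number-∈ {x ∷ xs} (here refl) = here refl
  number-∈ {x ∷ xs} (there ∈xs) = there (number-∈ ∈xs)

  ∈-number : ∀ {xs : List A} {x} → x ∈ xs → ∃[ g ] (g , x) ∈ number xs
  ∈-number (here refl) = _ , here refl
  ∈-number (there x∈)  = let g , gx∈ = ∈-number x∈ in g , there gx∈

  number-functional : ∀ {xs : List A} {g x y} → (g , x) ∈ number xs → (g , y) ∈ number xs → x ≡ y
  number-functional {x ∷ xs} (here refl) (here refl) = refl
  number-functional {x ∷ xs} (here refl) (there y∈)  = contradiction (number-< y∈) (ℕ.<-irrefl refl)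
  number-functional {x ∷ xs} (there x∈)  (here refl) = contradiction (number-< x∈) (ℕ.<-irrefl refl)
  number-functional {x ∷ xs} (there x∈)  (there y∈)  = number-functional x∈ y∈

  number-onto : ∀ (xs : List A) {g} → g < length xs → ∃[ x ] (g , x) ∈ number xs
  number-onto (x ∷ xs) {g} g< with g ℕ.≟ length xs
  ... | yes refl = x , here refl
  ... | no  g≢   = let y , y∈ = number-onto xs (ℕ.≤∧≢⇒< (ℕ.≤-pred g<) g≢) in y , there y∈

  ∈⇒lookup : ∀ {xs : List A} {x} → x ∈ xs → ∃[ u ] lookup xs u ≡ x
  ∈⇒lookup (here refl) = zero , refl
  ∈⇒lookup (there x∈)  = let u , eq = ∈⇒lookup x∈ in suc u , eq

injective⇒surjective : ∀ {m n} {f : Fin m → Fin n} → n ≤ m → Injective _≡_ _≡_ f →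
  ∀ j → ∃[ i ] f i ≡ j
injective⇒surjective {m} {suc n} {f} n≤m inj j with Fin.any? (λ i → f i Fin.≟ j)
... | yes found = found
... | no  none  = contradiction
  (Fin.injective⇒≤ {f = λ i → punchOut (j≢ i)} (λ eq → inj (Fin.punchOut-injective (j≢ _) (j≢ _) eq)))
  (ℕ.<⇒≱ n≤m)
  where
  j≢ : ∀ i → j ≢ f i
  j≢ i eq = none (i , sym eq)

element-∈ : ∀ {n} (S : Subset n) i → element S i Subset.∈ S
element-∈ (inside  ∷ S) zero    = Vec.here
element-∈ (inside  ∷ S) (suc i) = Vec.there (element-∈ S i)
element-∈ (outside ∷ S) i       = Vec.there (element-∈ S i)

element-injective : ∀ {n} (S : Subset n) {i j} → element S i ≡ element S j → i ≡ j
element-injective (inside  ∷ S) {zero}  {zero}  eq = refl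
element-injective (inside  ∷ S) {suc i} {suc j} eq = cong suc (element-injective S (Fin.suc-injective eq))
element-injective (outside ∷ S) eq = element-injective S (Fin.suc-injective eq)

∈-element : ∀ {n} {S : Subset n} {v} → v Subset.∈ S → ∃[ i ] element S i ≡ v
∈-element {S = inside  ∷ S} {zero}  Vec.here       = zero , refl
∈-element {S = inside  ∷ S} {suc v} (Vec.there v∈) = let i , eq = ∈-element v∈ in suc i , cong suc eq
∈-element {S = outside ∷ S} {suc v} (Vec.there v∈) = let i , eq = ∈-element v∈ in i , cong suc eq

image : ∀ {m n} → (Fin m → Fin n) → Subset n
image f = tabulate (λ v → does (Fin.any? (λ i → f i Fin.≟ v)))

∈-image⁻ : ∀ {m n} (f : Fin m → Fin n) {v} → v Subset.∈ image f → ∃[ i ] f i ≡ v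
∈-image⁻ f {v} v∈
  with eq ← trans (sym (Vec.lookup∘tabulate _ v)) (Vec.[]=⇒lookup v∈)
  with Fin.any? (λ i → f i Fin.≟ v)
... | yes found = found

∈-image⁺ : ∀ {m n} (f : Fin m → Fin n) i → f i Subset.∈ image f
∈-image⁺ f i = Vec.lookup⇒[]= (f i) _
  (trans (Vec.lookup∘tabulate _ (f i)) (dec-true (Fin.any? (λ j → f j Fin.≟ f i)) (i , refl)))

∣image∣≥ : ∀ {m n} {f : Fin m → Fin n} → Injective _≡_ _≡_ f → m ≤ ∣ image f ∣
∣image∣≥ {f = f} inj = Fin.injective⇒≤ {f = index} λ {i} {j} eq → inj
  (trans (sym (proj₂ (∈-element (∈-image⁺ f i))))
  (trans (cong (element (image f)) eq) (proj₂ (∈-element (∈-image⁺ f j)))))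
  where
  index : Fin _ → Fin _
  index i = proj₁ (∈-element (∈-image⁺ f i))

literalLabels⁻ : ∀ {ys g p x l} → l ∈ literalLabels ys g (p , x) →
  ∃[ y ] y ∈ ys × bit y (column x) ≡ p × l ≡ (g , row x , y)
literalLabels⁻ {ys} {g} {p} {x} l∈
  with y , y∈ , l∈y ← find (∈-concatMap⁻ _ {xs = ys} l∈)
  with bit y (column x) xor p in eq
... | false with here refl ← l∈y = y , y∈ , xor-false eq , refl

literalLabels⁺ : ∀ {ys g p x y} → y ∈ ys → bit y (column x) ≡ p →
  (g , row x , y) ∈ literalLabels ys g (p , x)
literalLabels⁺ {x = x} {y} y∈ refl = ∈-concatMap⁺ _ (Any.map (λ { refl → member }) y∈)
  where
  member : _ ∈ (if bit y (column x) xor bit y (column x) then [] else _ ∷ [])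
  member rewrite xor-same (bit y (column x)) = here refl

IsLabel : List (List Bool) → List (ℕ × RawClause) → Label → Set
IsLabel ys gs l = ∃[ g ] ∃[ c ] ∃[ p ] ∃[ x ] ∃[ y ] (g , c) ∈ gs × (p , x) ∈ c × y ∈ ys ×
  bit y (column x) ≡ p × l ≡ (g , row x , y)

IsVertexLabel : ℕ → List RawClause → Label → Set
IsVertexLabel N cs = IsLabel (bitVectors (suc (row N))) (groups N cs)

labels⁻ : ∀ {ys gs l} → l ∈ labels ys gs → IsLabel ys gs l
labels⁻ {ys} {gs} l∈
  with (g , c) , gc∈ , l∈gc ← find (∈-concatMap⁻ _ {xs = gs} l∈)
  with (p , x) , px∈ , l∈px ← find (∈-concatMap⁻ _ {xs = c} l∈gc)
  with y , y∈ , bit≡ , l≡ ← literalLabels⁻ {ys} {g} {p} {x} l∈px =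
  g , c , p , x , y , gc∈ , px∈ , y∈ , bit≡ , l≡

labels⁺ : ∀ {ys gs l} → IsLabel ys gs l → l ∈ labels ys gs
labels⁺ (g , c , p , x , y , gc∈ , px∈ , y∈ , bit≡ , refl) =
  ∈-concatMap⁺ _ (lose gc∈ (∈-concatMap⁺ _ (lose px∈ (literalLabels⁺ {g = g} {p} {x} y∈ bit≡))))

bitVectors-complete : ∀ k (f : ℕ → Bool) →
  ∃[ y ] y ∈ bitVectors k × (∀ {i} → i < k → bit y i ≡ f i)
bitVectors-complete zero    f = [] , here refl , λ ()
bitVectors-complete (suc k) f with y , y∈ , eq ← bitVectors-complete k (f ∘ suc) =
  f 0 ∷ y , extend y∈ (f 0) , λ { {zero} _ → refl ; {suc i} i< → eq (ℕ.≤-pred i<) }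
  where
  extend : ∀ {y ys} → y ∈ ys → ∀ b →
    (b ∷ y) ∈ foldr (λ y ys → (true ∷ y) ∷ (false ∷ y) ∷ ys) [] ys
  extend (here refl) true  = here refl
  extend (here refl) false = there (here refl)
  extend (there y∈)  b     = there (there (extend y∈ b))

-- The triangular enumeration of matrix positions

column+gap : ∀ x → let i , j , d = triangular x in j + d ≡ i
column+gap zero = refl
column+gap (suc x) with triangular x | column+gap x
... | i , j , zero  | eq = refl
... | i , j , suc d | eq = trans (sym (ℕ.+-suc j d)) eq

column≤row : ∀ x → column x ≤ row x
column≤row x = subst (column x ≤_) (column+gap x) (ℕ.m≤m+n (column x) _)

row-suc : ∀ x → row (suc x) ≡ row x ⊎ row (suc x) ≡ suc (row x)
row-suc x with triangular x
... | i , j , zero  = inj₂ refl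
... | i , j , suc d = inj₁ refl

row-mono : ∀ {x y} → x ≤ y → row x ≤ row y
row-mono {zero}  {zero}  _   = ℕ.≤-refl
row-mono {x} {suc y} x≤ with x ℕ.≟ suc y
... | yes refl = ℕ.≤-refl
... | no  x≢   = ℕ.≤-trans (row-mono (ℕ.≤-pred (ℕ.≤∧≢⇒< x≤ x≢))) (step (row-suc y))
  where
  step : row (suc y) ≡ row y ⊎ row (suc y) ≡ suc (row y) → row y ≤ row (suc y)
  step (inj₁ eq) = ℕ.≤-reflexive (sym eq)
  step (inj₂ eq) = subst (row y ≤_) (sym eq) (ℕ.n≤1+n _)

row≤ : ∀ x → row x ≤ x
row≤ zero = z≤n
row≤ (suc x) with row-suc x
... | inj₁ eq = subst (_≤ suc x) (sym eq) (ℕ.m≤n⇒m≤1+n (row≤ x))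
... | inj₂ eq = subst (_≤ suc x) (sym eq) (s≤s (row≤ x))

-- `row` starts at 0 and grows by at most 1 at a time, so it skips no value. This supplies, for
-- every variable `x`, a variable whose row is `column x`.
row-onto : ∀ x {i} → i ≤ row x → ∃[ x′ ] x′ ≤ x × row x′ ≡ i
row-onto zero    z≤n = zero , z≤n , refl
row-onto (suc x) {i} i≤ with i ℕ.≟ row (suc x) | row-suc x
... | yes refl | _ = suc x , ℕ.≤-refl , refl
... | no  i≢   | inj₁ eq =
  let x′ , ≤x , eq′ = row-onto x (subst (i ≤_) eq i≤) in x′ , ℕ.m≤n⇒m≤1+n ≤x , eq′
... | no  i≢   | inj₂ eq =
  let x′ , ≤x , eq′ = row-onto x (ℕ.≤-pred (subst (i <_) eq (ℕ.≤∧≢⇒< i≤ i≢))) in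
  x′ , ℕ.m≤n⇒m≤1+n ≤x , eq′

triangle : ℕ → ℕ
triangle zero    = 0
triangle (suc i) = triangle i + suc i

-- This inverts the enumeration, which turns an assignment into a matrix. It also bounds `row N` by
-- the square root of 2N.
triangle-row : ∀ x → triangle (row x) + column x ≡ x
triangle-row zero = refl
triangle-row (suc x) with triangular x | column+gap x | triangle-row x
... | i , j , zero  | eq | ih rewrite sym eq | ℕ.+-identityʳ j =
  trans (ℕ.+-identityʳ _) (trans (ℕ.+-suc _ _) (cong suc ih))
... | i , j , suc d | eq | ih = trans (ℕ.+-suc _ _) (cong suc ih)

-- Satisfying assignments as transversals of the cliques

tautology-∈ : ∀ {x N cs} → x < N → tautology x ∈ addTautologies N cs
tautology-∈ {x} {suc N} x<N with x ℕ.≟ N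
... | yes refl = here refl
... | no  x≢   = there (tautology-∈ (ℕ.≤∧≢⇒< (ℕ.≤-pred x<N) x≢))

∈-addTautologies : ∀ {c} N {cs} → c ∈ cs → c ∈ addTautologies N cs
∈-addTautologies zero    c∈ = c∈
∈-addTautologies (suc N) c∈ = there (∈-addTautologies N c∈)

addTautologies-∈ : ∀ {c} N {cs} → c ∈ addTautologies N cs →
  (∃[ x ] x < N × c ≡ tautology x) ⊎ c ∈ cs
addTautologies-∈ zero    c∈          = inj₂ c∈
addTautologies-∈ (suc N) (here refl) = inj₁ (N , ℕ.≤-refl , refl)
addTautologies-∈ (suc N) (there c∈) with addTautologies-∈ N c∈
... | inj₁ (x , x< , eq) = inj₁ (x , ℕ.m≤n⇒m≤1+n x< , eq)
... | inj₂ c∈cs          = inj₂ c∈cs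

RawSatisfies : (ℕ → Bool) → List RawClause → Set
RawSatisfies α cs = ∀ {c} → c ∈ cs → ∃[ p ] ∃[ x ] (p , x) ∈ c × α x ≡ p

VariablesBelow : ℕ → List RawClause → Set
VariablesBelow N cs = ∀ {c p x} → c ∈ cs → (p , x) ∈ c → x < N

addTautologies-below : ∀ N {cs} → VariablesBelow N cs → VariablesBelow N (addTautologies N cs)
addTautologies-below N below c∈ px∈ with addTautologies-∈ N c∈ | px∈
... | inj₁ (x , x< , refl) | here refl         = x<
... | inj₁ (x , x< , refl) | there (here refl) = x<
... | inj₂ c∈cs            | px∈c              = below c∈cs px∈c

addTautologies-satisfied : ∀ N {α cs} → RawSatisfies α cs → RawSatisfies α (addTautologies N cs)
addTautologies-satisfied N {α} sat c∈ with addTautologies-∈ N c∈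
... | inj₂ c∈cs            = sat c∈cs
... | inj₁ (x , x< , refl) with α x in eq
...   | true  = true , x , here refl , eq
...   | false = false , x , there (here refl) , eq

-- Of the list of labels only its members matter here, not their order or multiplicity.
module Reduction (N : ℕ) (cs : List RawClause) (below : VariablesBelow N cs) (ls : List Label)
  (ls⁻ : ∀ {l} → l ∈ ls → IsVertexLabel N cs l)
  (ls⁺ : ∀ {l} → IsVertexLabel N cs l → l ∈ ls)
  where

  all : List RawClause
  all = addTautologies N cs

  -- Rows are counted from 0. The last row in use is that of `N ∸ 1`; taking `row N` costs at most
  -- one extra row and treats N = 0 alike.
  k : ℕ
  k = suc (row N)

  vs : List Vertex
  vs = number ls

  G : Graph (length vs)
  G = graph vs

  label : Fin (length vs) → Label
  label u = proj₂ (lookup vs u)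

  label-∈ : ∀ u → label u ∈ ls
  label-∈ u = number-∈ (∈-lookup {xs = vs} u)

  group< : ∀ u → group (lookup vs u) < length all
  group< u with g , c , p , x , y , gc∈ , _ , _ , _ , eq ← ls⁻ (label-∈ u)
    rewrite eq = number-< gc∈

  -- The case `u` = `v` is included: equal tags mean equal vertices, and a vertex is consistent with
  -- itself.
  nonadjacent-crossing : ∀ {u v} → edge G u v ≡ false →
    crossing (lookup vs u) (lookup vs v) ≡ crossing (lookup vs v) (lookup vs u)
  nonadjacent-crossing {u} {v} eq with nonadjacent⁻ (lookup vs u) (lookup vs v) eq
  ... | inj₁ same rewrite number-injective ls {u} {v} same = refl
  ... | inj₂ (_ , crossing≡) = crossing≡

  RowOf : (ℕ → ℕ → Bool) → ℕ → Label → Set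
  RowOf M g (h , i , y) = h ≡ g × i < k × (∀ {j} → j < k → bit y j ≡ M i j)

  module _ (M : ℕ → ℕ → Bool) (M-sym : ∀ i j → M i j ≡ M j i) {m : ℕ}
           (pick : ∀ g → g < m → ∃[ u ] RowOf M g (label u)) where

    private
      f : Fin m → Fin (length vs)
      f i = proj₁ (pick (toℕ i) (Fin.toℕ<n i))

      f-group : ∀ i → group (lookup vs (f i)) ≡ toℕ i
      f-group i = proj₁ (proj₂ (pick (toℕ i) (Fin.toℕ<n i)))

      rows-crossing : ∀ {g h} u v → RowOf M g (proj₂ u) → RowOf M h (proj₂ v) →
        crossing u v ≡ crossing v u
      rows-crossing (_ , _ , i , _) (_ , _ , j , _) (_ , i< , y≡) (_ , j< , z≡) =
        trans (y≡ j<) (trans (M-sym i j) (sym (z≡ i<)))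

      f-injective : Injective _≡_ _≡_ f
      f-injective {i} {j} eq = Fin.toℕ-injective
        (trans (sym (f-group i)) (trans (cong (group ∘ lookup vs) eq) (f-group j)))

      independent : IsIndependent G (image f)
      independent u∈ v∈ with i , refl ← ∈-image⁻ f u∈ | j , refl ← ∈-image⁻ f v∈ with i Fin.≟ j
      ... | yes refl = irrefl G (f i)
      ... | no  i≢j  = nonadjacent⁺ (lookup vs (f i)) (lookup vs (f j))
        (λ eq → i≢j (Fin.toℕ-injective (trans (sym (f-group i)) (trans eq (f-group j)))))
        (rows-crossing (lookup vs (f i)) (lookup vs (f j))
          (proj₂ (pick (toℕ i) (Fin.toℕ<n i))) (proj₂ (pick (toℕ j) (Fin.toℕ<n j))))

    -- Vertices in distinct groups are adjacent only if inconsistent, and rows i and j of one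
    -- symmetric matrix are consistent because `M i j` equals `M j i`.
    transversal : ∃[ S ] IsIndependent G S × m ≤ ∣ S ∣
    transversal = image f , independent , ∣image∣≥ f-injective

  module Soundness {S} (independent : IsIndependent G S) (large : length all ≤ ∣ S ∣) where

    groupOf : Fin ∣ S ∣ → Fin (length all)
    groupOf i = fromℕ< (group< (element S i))

    groupOf-injective : Injective _≡_ _≡_ groupOf
    groupOf-injective {i} {j} eq
      with nonadjacent⁻ (lookup vs (element S i)) (lookup vs (element S j))
             (independent (element-∈ S i) (element-∈ S j))
    ... | inj₁ same     = element-injective S (number-injective ls same)
    ... | inj₂ (g≢ , _) = contradiction (Fin.fromℕ<-injective _ _ _ _ eq) g≢

    abstract
      -- An independent set has at most one vertex in each clique, so one with as many vertices as
      -- there are cliques misses none.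
      occupied : ∀ {g} → g < length all → ∃[ u ] u Subset.∈ S × group (lookup vs u) ≡ g
      occupied g< with i , eq ← injective⇒surjective large groupOf-injective (fromℕ< g<) =
        element S i , element-∈ S i ,
        trans (sym (Fin.toℕ-fromℕ< _)) (trans (cong toℕ eq) (Fin.toℕ-fromℕ< g<))

    Chosen : RawClause → Fin (length vs) → Set
    Chosen c u = ∃[ p ] ∃[ x ] ∃[ y ]
      (p , x) ∈ c × proj₂ (label u) ≡ (row x , y) × bit y (column x) ≡ p

    private
      chosen-in-group : ∀ {g c u} → (g , c) ∈ groups N cs → group (lookup vs u) ≡ g → Chosen c u
      chosen-in-group {u = u} gc∈ refl
        with g , c , p , x , y , gc∈′ , px∈ , _ , bit≡ , l≡ ← ls⁻ (label-∈ u)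
        with refl ← cong proj₁ l≡
        with refl ← number-functional gc∈ gc∈′ =
        p , x , y , px∈ , cong proj₂ l≡ , bit≡

      row-of-tautology : ∀ {x u} → Chosen (tautology x) u → ∃[ y ] proj₂ (label u) ≡ (row x , y)
      row-of-tautology (_ , _ , y , here refl , l≡ , _)         = y , l≡
      row-of-tautology (_ , _ , y , there (here refl) , l≡ , _) = y , l≡

    abstract
      chosen : ∀ {c} → c ∈ all → ∃[ u ] u Subset.∈ S × Chosen c u
      chosen c∈ = let g , gc∈ = ∈-number c∈ ; u , u∈ , eq = occupied (number-< gc∈) in
        u , u∈ , chosen-in-group gc∈ eq

      choice : ∀ {x} → x < N → ∃[ u ] u Subset.∈ S × ∃[ y ] proj₂ (label u) ≡ (row x , y)
      choice x< = let u , u∈ , ch = chosen (tautology-∈ {cs = cs} x<) in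
        u , u∈ , row-of-tautology {u = u} ch

    crossing-bits : ∀ {u v i j y z} → u Subset.∈ S → v Subset.∈ S →
      proj₂ (label u) ≡ (i , y) → proj₂ (label v) ≡ (j , z) → bit y j ≡ bit z i
    crossing-bits {u} {v} u∈ v∈ l≡ l≡′ with eq ← nonadjacent-crossing {u} {v} (independent u∈ v∈)
      rewrite l≡ | l≡′ = eq

    -- A chosen vertex v with row index column x exists; both bits agree
    -- with its bit at row x.

    choice-irrelevant : ∀ {u u′ x y y′} → x < N → u Subset.∈ S → u′ Subset.∈ S →
      proj₂ (label u) ≡ (row x , y) → proj₂ (label u′) ≡ (row x , y′) →
      bit y (column x) ≡ bit y′ (column x)
    choice-irrelevant {x = x} x< u∈ u′∈ l≡ l≡′
      with x″ , x″≤ , row≡ ← row-onto x (column≤row x)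
      with v , v∈ , z , l≡″ ← choice (ℕ.≤-<-trans x″≤ x<)
      rewrite sym row≡ =
      trans (crossing-bits u∈ v∈ l≡ l≡″) (sym (crossing-bits u′∈ v∈ l≡′ l≡″))

    assignment : ℕ → Bool
    assignment x with x ℕ.<? N
    ... | yes x< = bit (proj₁ (proj₂ (proj₂ (choice x<)))) (column x)
    ... | no  _  = false

    -- The vertex chosen in a clause makes a literal true by its own claim, while `assignment` reads
    -- the claim chosen for the tautology of that variable; `choice-irrelevant` identifies the two
    -- bits.
    satisfied : RawSatisfies assignment cs
    satisfied c∈ with u , u∈ , p , x , y , px∈ , l≡ , bit≡ ← chosen (∈-addTautologies N c∈) =
      p , x , px∈ , value
      where
      value : assignment x ≡ p
      value with x ℕ.<? N
      ... | no  x≮ = contradiction (below c∈ px∈) x≮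
      ... | yes x< with u′ , u′∈ , y′ , l≡′ ← choice x< =
        trans (choice-irrelevant x< u′∈ u∈ l≡′ l≡) bit≡

  module Completeness {α : ℕ → Bool} (sat : RawSatisfies α cs) where

    -- The symmetric matrix with entry α x at (row x , column x).

    entry : ℕ → ℕ → Bool
    entry i j = α (triangle (i ⊔ j) + i ⊓ j)

    entry-sym : ∀ i j → entry i j ≡ entry j i
    entry-sym i j = cong₂ (λ m n → α (triangle m + n)) (ℕ.⊔-comm i j) (ℕ.⊓-comm i j)

    entry-value : ∀ x → entry (row x) (column x) ≡ α x
    entry-value x rewrite ℕ.m≥n⇒m⊔n≡m (column≤row x) | ℕ.m≥n⇒m⊓n≡n (column≤row x) =
      cong α (triangle-row x)

    -- Each clause contributes a vertex that claims the actual row of one of its literals true under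
    -- `α`; that literal being true is what makes this row a label.
    pick : ∀ g → g < length all → ∃[ u ] RowOf entry g (label u)
    pick g g<
      with c , gc∈ ← number-onto all g<
      with p , x , px∈ , αx≡p ← addTautologies-satisfied N sat (number-∈ gc∈)
      with y , y∈ , bit≡ ← bitVectors-complete k (entry (row x))
      = let
        x<N  = addTautologies-below N below (number-∈ gc∈) px∈
        row< = s≤s (row-mono (ℕ.<⇒≤ x<N))
        l∈   = ls⁺ (_ , _ , _ , _ , _ , gc∈ , px∈ , y∈ ,
          trans (bit≡ (ℕ.≤-<-trans (column≤row x) row<)) (trans (entry-value x) αx≡p) , refl)
        u , eq = ∈⇒lookup (proj₂ (∈-number l∈))
      in u , subst (RowOf entry g) (sym (cong proj₂ eq)) (refl , row< , bit≡)

    independent-set : ∃[ S ] IsIndependent G S × length all ≤ ∣ S ∣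
    independent-set = transversal entry entry-sym pick

-- Rank and linear rank-width

open MonoidSum (CommutativeRing.+-monoid 𝔽₂) using (sum)

infix 7 _·_

_·_ : ∀ {m} → Subset m → (Fin m → Bool) → Bool
c · φ = sum (λ i → Vec.lookup c i ∧ φ i)

·-cong : ∀ {m} (c : Subset m) {φ ψ} → φ ≗ ψ → c · φ ≡ c · ψ
·-cong []      eq = refl
·-cong (b ∷ c) eq = cong₂ (λ x y → (b ∧ x) xor y) (eq zero) (·-cong c (eq ∘ suc))

·-zero : ∀ {m} (c : Subset m) → c · (λ _ → false) ≡ false
·-zero []      = refl
·-zero (b ∷ c) rewrite ∧-zeroʳ b = ·-zero c

open CommutativeSemigroup (CommutativeRing.+-commutativeSemigroup 𝔽₂)
  using () renaming (interchange to xor-interchange)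

·-xor : ∀ {m} (c : Subset m) φ ψ → c · (λ i → φ i xor ψ i) ≡ (c · φ) xor (c · ψ)
·-xor []      φ ψ = refl
·-xor (b ∷ c) φ ψ = trans
  (cong₂ _xor_ (∧-distribˡ-xor b (φ zero) (ψ zero)) (·-xor c (φ ∘ suc) (ψ ∘ suc)))
  (xor-interchange (b ∧ φ zero) (b ∧ ψ zero) (c · (φ ∘ suc)) (c · (ψ ∘ suc)))

xor-· : ∀ {m} (c d : Subset m) φ → zipWith _xor_ c d · φ ≡ (c · φ) xor (d · φ)
xor-· []      []      φ = refl
xor-· (a ∷ c) (b ∷ d) φ = trans
  (cong₂ _xor_ (∧-distribʳ-xor (φ zero) a b) (xor-· c d (φ ∘ suc)))
  (xor-interchange (a ∧ φ zero) (b ∧ φ zero) (c · (φ ∘ suc)) (d · (φ ∘ suc)))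

-- Bounding rank by spanning functions

-- All that is needed of a span is that a coefficient vector annihilating the generators annihilates
-- everything, which is an induction on this form. Functions are compared pointwise, whence
-- `respects`.
data Span {m} (Φ : List (Fin m → Bool)) : (Fin m → Bool) → Set where
  generator : ∀ {φ} → φ ∈ Φ → Span Φ φ
  zero      : Span Φ (λ _ → false)
  add       : ∀ {φ ψ} → Span Φ φ → Span Φ ψ → Span Φ (λ i → φ i xor ψ i)
  respects  : ∀ {φ ψ} → φ ≗ ψ → Span Φ φ → Span Φ ψ

annihilates : ∀ {m} {Φ : List (Fin m → Bool)} (c : Subset m) →
  All (λ φ → c · φ ≡ false) Φ → ∀ {φ} → Span Φ φ → c · φ ≡ false
annihilates c ann (generator φ∈)  = All.lookup ann φ∈
annihilates c ann zero            = ·-zero c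
annihilates c ann (add {φ} {ψ} s t) =
  trans (·-xor c φ ψ) (cong₂ _xor_ (annihilates c ann s) (annihilates c ann t))
annihilates c ann (respects eq s) = trans (sym (·-cong c eq)) (annihilates c ann s)

private
  bool : Fin 2 → Bool
  bool zero       = false
  bool (suc zero) = true

  bool-injective : ∀ {i j} → bool i ≡ bool j → i ≡ j
  bool-injective {zero}     {zero}     eq = refl
  bool-injective {zero}     {suc zero} ()
  bool-injective {suc zero} {suc zero} eq = refl

  digit : Bool → Fin 2
  digit false = zero
  digit true  = suc zero

  digit-injective : ∀ {a b} → digit a ≡ digit b → a ≡ b
  digit-injective {false} {false} eq = refl
  digit-injective {true}  {true}  eq = refl

subsetOf : ∀ {m} (S : Subset m) → Fin (2 ^ ∣ S ∣) → Subset m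
subsetOf []            _ = []
subsetOf (inside  ∷ S) i = let b , j = remQuot {2} (2 ^ ∣ S ∣) i in bool b ∷ subsetOf S j
subsetOf (outside ∷ S) i = outside ∷ subsetOf S i

subsetOf-⊆ : ∀ {m} (S : Subset m) i → subsetOf S i ⊆ S
subsetOf-⊆ (inside  ∷ S) i {zero}  _            = Vec.here
subsetOf-⊆ (inside  ∷ S) i {suc x} (Vec.there x∈) = Vec.there (subsetOf-⊆ S _ x∈)
subsetOf-⊆ (outside ∷ S) i (Vec.there x∈) = Vec.there (subsetOf-⊆ S i x∈)

subsetOf-injective : ∀ {m} (S : Subset m) → Injective _≡_ _≡_ (subsetOf S)
subsetOf-injective [] {zero} {zero} eq = refl
subsetOf-injective (inside ∷ S) {i} {j} eq = trans (sym (Fin.combine-remQuot {2} (2 ^ ∣ S ∣) i)) (trans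
  (cong₂ combine (bool-injective (Vec.∷-injectiveˡ eq)) (subsetOf-injective S (Vec.∷-injectiveʳ eq)))
  (Fin.combine-remQuot {2} (2 ^ ∣ S ∣) j))
subsetOf-injective (outside ∷ S) eq = subsetOf-injective S (Vec.∷-injectiveʳ eq)

-- The values of `c` on all of `Φ`, packed into one number, so that the pigeonhole principle
-- applies.
code : ∀ {m} (Φ : List (Fin m → Bool)) → Subset m → Fin (2 ^ length Φ)
code []      c = zero
code (φ ∷ Φ) c = combine (digit (c · φ)) (code Φ c)

code-difference : ∀ {m} (Φ : List (Fin m → Bool)) {c d} → code Φ c ≡ code Φ d →
  All (λ φ → zipWith _xor_ c d · φ ≡ false) Φ
code-difference []      eq = []
code-difference (φ ∷ Φ) {c} {d} eq
  with eq₁ , eq₂ ← Fin.combine-injective (digit (c · φ)) (code Φ c) (digit (d · φ)) (code Φ d) eq =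
  trans (xor-· c d φ) (trans (cong (_xor (d · φ)) (digit-injective eq₁)) (xor-same (d · φ))) ∷
  code-difference Φ eq₂

xor-⊆ : ∀ {m} {S c d : Subset m} → c ⊆ S → d ⊆ S → zipWith _xor_ c d ⊆ S
xor-⊆ {c = true  ∷ c} {b ∷ d}    c⊆ d⊆ {zero}  _ = c⊆ Vec.here
xor-⊆ {c = false ∷ c} {true ∷ d} c⊆ d⊆ {zero}  _ = d⊆ Vec.here
xor-⊆ {S = s ∷ S} {a ∷ c} {b ∷ d} c⊆ d⊆ {suc x} (Vec.there x∈) =
  Vec.there (xor-⊆ (Subset.drop-∷-⊆ c⊆) (Subset.drop-∷-⊆ d⊆) x∈)

xor≡⊥ : ∀ {m} (c d : Subset m) → zipWith _xor_ c d ≡ ⊥ → c ≡ d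
xor≡⊥ []      []      eq = refl
xor≡⊥ (a ∷ c) (b ∷ d) eq =
  cong₂ _∷_ (xor-false (Vec.∷-injectiveˡ eq)) (xor≡⊥ c d (Vec.∷-injectiveʳ eq))

-- Counting replaces elimination. If independent rows `S` outnumbered `Φ`, two of the 2 ^ |S|
-- coefficient vectors supported in `S` would agree on all of `Φ`; their sum would be nonzero and
-- annihilate every column.
rank≤ : ∀ {m n} (M : Matrix m n) Φ → (∀ j → Span Φ (λ i → M i j)) → rank M ≤ length Φ
rank≤ M Φ spans with S , independent , eq ← rank-attained M =
  subst (_≤ length Φ) eq (ℕ.≮⇒≥ absurd)
  where
  absurd : ¬ length Φ < ∣ S ∣
  absurd Φ<S with i , j , i<j , same ← Fin.pigeonhole (ℕ.^-monoʳ-< 2 (s≤s (s≤s z≤n)) Φ<S) (code Φ ∘ subsetOf S) =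
    Fin.<⇒≢ i<j (subsetOf-injective S (xor≡⊥ c d (independent (zipWith _xor_ c d)
      (xor-⊆ (subsetOf-⊆ S i) (subsetOf-⊆ S j))
      (λ l → annihilates (zipWith _xor_ c d) (code-difference Φ same) (spans l)))))
    where
    c = subsetOf S i
    d = subsetOf S j

-- The cuts of the constructed graph

rowIndex : Vertex → ℕ
rowIndex (_ , _ , i , _) = i

bitOf : Vertex → ℕ → Bool
bitOf (_ , _ , _ , y) = bit y

module _ {m : ℕ} (vertex : Fin m → Vertex) where

  -- The coordinates of the vector (e i , y) of a vertex, restricted to the set of vertices with
  -- characteristic function `q`.
  weightedBit weightedRow : (Fin m → Bool) → ℕ → Fin m → Bool
  weightedBit q r u = q u ∧ bitOf (vertex u) r
  weightedRow q r u = q u ∧ (rowIndex (vertex u) ≡ᵇ r)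

  module _ {Φ : List (Fin m → Bool)} where

    span-scale : ∀ {φ} b → Span Φ φ → Span Φ (λ i → φ i ∧ b)
    span-scale {φ} true  s = respects (λ i → sym (∧-identityʳ (φ i))) s
    span-scale {φ} false s = respects (λ i → sym (∧-zeroʳ (φ i))) zero

    -- A function of an index below `k` is the sum of the `k` indicators of single indices with its
    -- values as coefficients; `below n` is the partial sum over indices below `n`.
    span-function : ∀ {q k} → (∀ {r} → r < k → Span Φ (weightedRow q r)) →
      (∀ u → rowIndex (vertex u) < k) → ∀ f → Span Φ (λ u → q u ∧ f (rowIndex (vertex u)))
    span-function {q} {k} rows row< f = respects (λ u → cong (q u ∧_) (full (row< u))) (partial k rows)
      where
      below : ℕ → ℕ → Bool
      below n i with i ℕ.<? n
      ... | yes _ = f i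
      ... | no  _ = false
      full : ∀ {i n} → i < n → below n i ≡ f i
      full {i} {n} i<n with i ℕ.<? n
      ... | yes _   = refl
      ... | no  i≮n = contradiction i<n i≮n
      below-suc : ∀ n i → below n i xor ((i ≡ᵇ n) ∧ f n) ≡ below (suc n) i
      below-suc n i with i ℕ.<? n | i ℕ.<? suc n | i ≡ᵇ n in i≟n
      ... | yes p | yes _ | true  = contradiction (≡ᵇ-sound i≟n) (ℕ.<⇒≢ p)
      ... | yes _ | yes _ | false = Bool.xor-identityʳ (f i)
      ... | yes p | no ¬q | _     = contradiction (ℕ.m≤n⇒m≤1+n p) ¬q
      ... | no _  | yes _ | true  = cong f (sym (≡ᵇ-sound i≟n))
      ... | no ¬p | yes q | false = contradiction (ℕ.≤∧≢⇒< (ℕ.≤-pred q) (≡ᵇ-complete i≟n)) ¬p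
      ... | no _  | no ¬q | true  = contradiction (s≤s (ℕ.≤-reflexive (≡ᵇ-sound i≟n))) ¬q
      ... | no _  | no _  | false = refl
      partial : ∀ n → (∀ {r} → r < n → Span Φ (weightedRow q r)) →
        Span Φ (λ u → q u ∧ below n (rowIndex (vertex u)))
      partial zero    _    = respects (λ u → sym (∧-zeroʳ (q u))) zero
      partial (suc n) rows = respects step
        (add (partial n (rows ∘ ℕ.m≤n⇒m≤1+n)) (span-scale (f n) (rows ℕ.≤-refl)))
        where
        step : ∀ u → _
        step u = trans
          (cong ((q u ∧ below n (rowIndex (vertex u))) xor_)
            (Bool.∧-assoc (q u) (rowIndex (vertex u) ≡ᵇ n) (f n)))
          (trans (sym (∧-distribˡ-xor (q u) (below n (rowIndex (vertex u))) _))
            (cong (q u ∧_) (below-suc n (rowIndex (vertex u)))))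

    -- For fixed `w`, one half of the form is a single bit coordinate of `u`, hence a generator; the
    -- other half depends on the row index of `u` alone.
    span-form : ∀ {q k} → (∀ {r} → r < k → Span Φ (weightedBit q r)) →
      (∀ {r} → r < k → Span Φ (weightedRow q r)) → (∀ u → rowIndex (vertex u) < k) →
      ∀ w → rowIndex w < k → Span Φ (λ u → q u ∧ (crossing (vertex u) w xor crossing w (vertex u)))
    span-form {q} bits rows row< w w< = respects
      (λ u → sym (∧-distribˡ-xor (q u) (crossing (vertex u) w) (crossing w (vertex u))))
      (add (bits w<) (span-function rows row< (bitOf w)))

  module _ (γ : ℕ) where

    inGroup outsideGroup anywhere : Fin m → Bool
    inGroup u      = group (vertex u) ≡ᵇ γ
    outsideGroup u = not (inGroup u)
    anywhere u     = true

    -- A column outside the group `γ` is the form itself. A column inside it is the indicator of `γ`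
    -- plus the form restricted to the complement of `γ`, as members of `γ` are adjacent whatever
    -- they claim. This takes two copies of the 2k coordinates and one indicator.
    features : ℕ → List (Fin m → Bool)
    features zero    = inGroup ∷ []
    features (suc r) = weightedBit anywhere r ∷ weightedRow anywhere r ∷
      weightedBit outsideGroup r ∷ weightedRow outsideGroup r ∷ features r

    length-features : ∀ k → length (features k) ≡ 1 + 4 * k
    length-features zero    = refl
    length-features (suc k) = trans (cong (4 +_) (length-features k)) (cong suc (sym (ℕ.*-suc 4 k)))

    inGroup-∈ : ∀ k → inGroup ∈ features k
    inGroup-∈ zero    = here refl
    inGroup-∈ (suc k) = there (there (there (there (inGroup-∈ k))))

    private
      at : ∀ {φ : ℕ → Fin m → Bool} → (∀ r → φ r ∈ features (suc r)) → ∀ {k r} → r < k → φ r ∈ features k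
      at here-∈ {suc k} {r} r< with r ℕ.≟ k
      ... | yes refl = here-∈ r
      ... | no  r≢   = there (there (there (there (at here-∈ (ℕ.≤∧≢⇒< (ℕ.≤-pred r<) r≢)))))

    span-adjacent : ∀ {k} → (∀ u → rowIndex (vertex u) < k) → ∀ w → rowIndex w < k →
      (∀ u → tag (vertex u) ≢ tag w) → (∀ u → group (vertex u) ≡ group w → group w ≡ γ) →
      Span (features k) (λ u → adjacent (vertex u) w)
    span-adjacent {k} row< w w< tag≢ group≡ with group w ℕ.≟ γ
    ... | no w≢γ = respects different (span-form {q = anywhere}
        (λ r< → generator (at (λ _ → here refl) r<))
        (λ r< → generator (at (λ _ → there (here refl)) r<)) row< w w<)
      where
      different : ∀ u → crossing (vertex u) w xor crossing w (vertex u) ≡ adjacent (vertex u) w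
      different u with tag (vertex u) ≡ᵇ tag w in eq | group (vertex u) ≡ᵇ group w in eq′
      ... | true  | _     = contradiction (≡ᵇ-sound eq) (tag≢ u)
      ... | false | true  = contradiction (group≡ u (≡ᵇ-sound eq′)) w≢γ
      ... | false | false = refl
    ... | yes refl = respects split (add (generator (inGroup-∈ k)) (span-form {q = outsideGroup}
        (λ r< → generator (at (λ _ → there (there (here refl))) r<))
        (λ r< → generator (at (λ _ → there (there (there (here refl)))) r<)) row< w w<))
      where
      split : ∀ u → inGroup u xor (outsideGroup u ∧ (crossing (vertex u) w xor crossing w (vertex u))) ≡
                    adjacent (vertex u) w
      split u with tag (vertex u) ≡ᵇ tag w in eq | group (vertex u) ≡ᵇ group w
      ... | true  | _     = contradiction (≡ᵇ-sound eq) (tag≢ u)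
      ... | false | true  = refl
      ... | false | false = refl

Descending : List Label → Set
Descending = AllPairs (λ l l′ → proj₁ l′ ≤ proj₁ l)

descending-lookup : ∀ {ls} → Descending ls → ∀ u v → toℕ u ≤ toℕ v →
  group (lookup (number ls) v) ≤ group (lookup (number ls) u)
descending-lookup (_ ∷ _)    zero    zero    _   = ℕ.≤-refl
descending-lookup {l ∷ ls} (l≥ ∷ _) zero (suc v) _ =
  All.lookup l≥ (number-∈ (∈-lookup {xs = number ls} v))
descending-lookup (_ ∷ desc) (suc u) (suc v) u≤v = descending-lookup desc u v (ℕ.≤-pred u≤v)

lrw≤ : ∀ {n B} (G : Graph n) π → (∀ i → cutRank G (prefix π i) ≤ B) → lrw G ≤ B
lrw≤ {n} {B} G π cut≤ = ℕ.≤-trans (lrw-lower G π)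
  (max≤v⁺ {v = B} {0} {map (cutRank G ∘ prefix π) (upTo (suc n))} z≤n
    (All.map⁺ (All.universal cut≤ (upTo (suc n)))))

module _ {ls k} (desc : Descending ls) (row< : All (λ (_ , i , _) → i < k) ls) where

  private
    vs : List Vertex
    vs = number ls

    G : Graph (length vs)
    G = graph vs

    row<k : ∀ v → rowIndex (lookup vs v) < k
    row<k v = All.lookup row< (number-∈ (∈-lookup {xs = vs} v))

    -- The only group with vertices on both sides of the cut at i.

    pivot : ℕ → ℕ
    pivot i with i ℕ.<? length vs
    ... | yes i< = group (lookup vs (fromℕ< i<))
    -- No vertex lies behind this cut, so any value will do.
    ... | no  _  = 0

    -- Groups descend, and position `i` lies after `u` and not after `v`, so its group is squeezed
    -- between two equal ones.
    pivot-group : ∀ {i} u v → toℕ u < i → i ≤ toℕ v →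
      group (lookup vs u) ≡ group (lookup vs v) → group (lookup vs v) ≡ pivot i
    pivot-group {i} u v u<i i≤v eq with i ℕ.<? length vs
    ... | no  i≮ = contradiction (ℕ.≤-<-trans i≤v (Fin.toℕ<n v)) i≮
    ... | yes i< = ℕ.≤-antisym
      (descending-lookup desc (fromℕ< i<) v (subst (_≤ toℕ v) (sym (Fin.toℕ-fromℕ< i<)) i≤v))
      (subst (group (lookup vs (fromℕ< i<)) ≤_) eq (descending-lookup desc u (fromℕ< i<)
        (subst (toℕ u ≤_) (sym (Fin.toℕ-fromℕ< i<)) (ℕ.<⇒≤ u<i))))

    cutRank≤ : ∀ i A → (∀ {v} → v Subset.∈ A → toℕ v < i) → (∀ {v} → v Subset.∈ ∁ A → i ≤ toℕ v) →
      cutRank G A ≤ 1 + 4 * k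
    cutRank≤ i A A< A≥ = ℕ.≤-trans
      (rank≤ (cutMatrix G A (∁ A)) (features vertex (pivot i) k) column-spans)
      (ℕ.≤-reflexive (length-features vertex (pivot i) k))
      where
      vertex : Fin ∣ A ∣ → Vertex
      vertex u = lookup vs (element A u)
      column-spans : ∀ j → Span (features vertex (pivot i) k) (λ u → cutMatrix G A (∁ A) u j)
      column-spans j = span-adjacent vertex (pivot i) (λ u → row<k (element A u)) (lookup vs w) (row<k w)
        (λ u eq → ℕ.<⇒≢ (ℕ.<-≤-trans (A< (element-∈ A u)) (A≥ (element-∈ (∁ A) j)))
          (cong toℕ (number-injective ls {element A u} {w} eq)))
        (λ u → pivot-group (element A u) w (A< (element-∈ A u)) (A≥ (element-∈ (∁ A) j)))
        where
        w = element (∁ A) j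

    prefix⁻ : ∀ {n i} {v : Fin n} → v Subset.∈ prefix Perm.id i → toℕ v < i
    prefix⁻ {i = i} {v} v∈ = ℕ.<ᵇ⇒< _ _ (subst T (sym (trans
      (sym (Vec.lookup∘tabulate (λ v → does (toℕ v ℕ.<? i)) v)) (Vec.[]=⇒lookup v∈))) _)

    prefix⁺ : ∀ {n i} {v : Fin n} → toℕ v < i → v Subset.∈ prefix Perm.id i
    prefix⁺ {i = i} {v} v<i = Vec.lookup⇒[]= v _
      (trans (Vec.lookup∘tabulate _ v) (dec-true (toℕ v ℕ.<? i) v<i))

  prefix-cutRank≤ : ∀ i → cutRank G (prefix Perm.id i) ≤ 1 + 4 * k
  prefix-cutRank≤ i = cutRank≤ i (prefix Perm.id i) prefix⁻
    (λ v∈∁ → ℕ.≮⇒≥ (λ v<i → Subset.x∈∁p⇒x∉p v∈∁ (prefix⁺ v<i)))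

lrw-graph≤ : ∀ ls k → Descending ls → All (λ (_ , i , _) → i < k) ls →
  lrw (graph (number ls)) ≤ 1 + 4 * k
lrw-graph≤ ls k desc row< =
  lrw≤ {B = 1 + 4 * k} (graph (number ls)) Perm.id (prefix-cutRank≤ desc row<)

same-group-descending : ∀ {g ls} → All (λ l → proj₁ l ≡ g) ls → Descending ls
same-group-descending []           = []
same-group-descending (refl ∷ eqs) =
  All.map ℕ.≤-reflexive eqs ∷ same-group-descending eqs

labels-descending : ∀ ys (cs : List RawClause) → Descending (labels ys (number cs))
labels-descending ys []       = []
labels-descending ys (c ∷ cs) = AllPairs.++⁺
  (same-group-descending first)
  (labels-descending ys cs)
  (All.map (λ eq → All.tabulate λ l∈ → subst (_ ≤_) (sym eq) (later l∈)) first)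
  where
  first : All (λ l → proj₁ l ≡ length cs) (concatMap (literalLabels ys (length cs)) c)
  first = All.concat⁺ (All.map⁺ (All.universal (λ (p , x) → All.tabulate λ l∈ →
    let _ , _ , _ , l≡ = literalLabels⁻ {ys} {length cs} {p} {x} l∈ in cong proj₁ l≡) c))
  label-≤ : ∀ {l} → IsLabel ys (number cs) l → proj₁ l ≤ length cs
  label-≤ (_ , _ , _ , _ , _ , gc∈ , _ , _ , _ , refl) = ℕ.<⇒≤ (number-< gc∈)
  later : ∀ {l} → l ∈ labels ys (number cs) → proj₁ l ≤ length cs
  later l∈ = label-≤ (labels⁻ {ys} {number cs} l∈)

-- Running times

sumBelow : (ℕ → ℕ) → ℕ → ℕ
sumBelow g zero    = 0
sumBelow g (suc K) = g K + sumBelow g K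

≤sumBelow : ∀ g {K l} → l < K → g l ≤ sumBelow g K
≤sumBelow g {suc K} {l} l< with l ℕ.≟ K
... | yes refl = ℕ.m≤m+n _ _
... | no  l≢   = ℕ.≤-trans (≤sumBelow g (ℕ.≤∧≢⇒< (ℕ.≤-pred l<) l≢)) (ℕ.m≤n+m _ (g K))

-- Only an upper bound on the linear rank-width is available and `g` need not be monotone, so `g`
-- has to be controlled at small arguments too. These are finitely many, and `B` absorbs their
-- values.
o[k²]-everywhere : ∀ {g} → g ∈o[k²] → ∀ m → ∃[ B ] ∀ l → m * g l ≤ l ^ 2 + B
o[k²]-everywhere {g} g∈o m with K , large ← g∈o m = m * sumBelow g K , bound
  where
  bound : ∀ l → m * g l ≤ l ^ 2 + m * sumBelow g K
  bound l with l ℕ.<? K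
  ... | yes l<K = ℕ.≤-trans (ℕ.*-monoʳ-≤ m (≤sumBelow g l<K)) (ℕ.m≤n+m _ (l ^ 2))
  ... | no  l≮K = ℕ.≤-trans (large l (ℕ.≮⇒≥ l≮K)) (ℕ.m≤m+n _ _)

2ab≤a²+b² : ∀ a b → 2 * (a * b) ≤ a * a + b * b
2ab≤a²+b² a b with ℕ.≤-total a b
... | inj₁ a≤b with d , refl ← ℕ.m≤n⇒∃[o]m+o≡n a≤b = subst (2 * (a * (a + d)) ≤_) (identity a d) (ℕ.m≤m+n _ (d * d))
  where
  identity : ∀ a d → 2 * (a * (a + d)) + d * d ≡ a * a + (a + d) * (a + d)
  identity = solve-∀
... | inj₂ b≤a with d , refl ← ℕ.m≤n⇒∃[o]m+o≡n b≤a = subst (2 * ((b + d) * b) ≤_) (identity b d) (ℕ.m≤m+n _ (d * d))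
  where
  identity : ∀ b d → 2 * ((b + d) * b) + d * d ≡ (b + d) * (b + d) + b * b
  identity = solve-∀

2triangle : ∀ i → 2 * triangle i ≡ i * i + i
2triangle zero    = refl
2triangle (suc i) = trans (ℕ.*-distribˡ-+ 2 (triangle i) (suc i))
  (trans (cong (_+ 2 * suc i) (2triangle i)) (identity i))
  where
  identity : ∀ i → i * i + i + 2 * suc i ≡ suc i * suc i + suc i
  identity = solve-∀

row²≤ : ∀ N → row N * row N ≤ 2 * N
row²≤ N = begin
  row N * row N         ≤⟨ ℕ.m≤m+n (row N * row N) (row N) ⟩
  row N * row N + row N ≡⟨ 2triangle (row N) ⟨
  2 * triangle (row N)  ≤⟨ ℕ.*-monoʳ-≤ 2 (ℕ.≤-trans (ℕ.m≤m+n (triangle (row N)) (column N)) (ℕ.≤-reflexive (triangle-row N))) ⟩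
  2 * N                 ∎
  where open ℕ.≤-Reasoning

-- Both g l and D * k are o(k²), and k² = O(N).  The factor 224 = 4 * 56
-- clears the denominators: l² ≤ 56 * i² + 25 and i² ≤ 2 * N for i = row N.

exponent≤ : ∀ {g} → g ∈o[k²] → ∀ q D → ∃[ E ] ∀ N l → let k = suc (row N) in
  l ≤ 1 + 4 * k → q * (g l + D * k) ≤ N + E
exponent≤ {g} g∈o q D with B , g≤ ← o[k²]-everywhere g∈o (224 * q) =
  25 + B + X * X + X , λ N l l≤ → bound N l (row N) l≤ (row²≤ N)
  where
  X = q * D
  open ℕ.≤-Reasoning
  square : ∀ l i → l ≤ 1 + 4 * suc i → l ^ 2 ≤ 56 * (i * i) + 25
  square l i l≤ = begin
    l ^ 2                                ≤⟨ ℕ.^-monoˡ-≤ 2 l≤ ⟩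
    (1 + 4 * suc i) ^ 2                  ≡⟨ identity i ⟩
    16 * (i * i) + 25 + 40 * i           ≤⟨ ℕ.+-monoʳ-≤ (16 * (i * i) + 25) (ℕ.*-monoʳ-≤ 40 (i≤i² i)) ⟩
    16 * (i * i) + 25 + 40 * (i * i)     ≡⟨ identity′ (i * i) ⟩
    56 * (i * i) + 25                    ∎
    where
    identity : ∀ i → (1 + 4 * suc i) * ((1 + 4 * suc i) * 1) ≡ 16 * (i * i) + 25 + 40 * i
    identity = solve-∀
    identity′ : ∀ j → 16 * j + 25 + 40 * j ≡ 56 * j + 25
    identity′ = solve-∀
    i≤i² : ∀ i → i ≤ i * i
    i≤i² zero    = z≤n
    i≤i² (suc i) = ℕ.m≤m*n (suc i) (suc i)
  bound : ∀ N l i → l ≤ 1 + 4 * suc i → i * i ≤ 2 * N → q * (g l + D * suc i) ≤ N + (25 + B + X * X + X)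
  bound N l i l≤ i² = begin
    q * (g l + D * suc i)              ≡⟨ identity q (g l) D i ⟩
    (q * g l + X * i) + X              ≤⟨ ℕ.+-monoˡ-≤ X (ℕ.*-cancelˡ-≤ 224 scaled) ⟩
    (N + (25 + B + X * X)) + X         ≡⟨ ℕ.+-assoc N _ X ⟩
    N + (25 + B + X * X + X)           ∎
    where
    identity : ∀ q a D i → q * (a + D * suc i) ≡ (q * a + q * D * i) + q * D
    identity = solve-∀
    identity₁ : ∀ q a X i → 224 * (q * a + X * i) ≡ 224 * q * a + 56 * (2 * (i * (2 * X)))
    identity₁ = solve-∀
    identity₂ : ∀ i² X B → (56 * i² + 25) + B + 56 * (i² + (2 * X) * (2 * X)) ≡
                           112 * i² + (25 + B + 224 * (X * X))
    identity₂ = solve-∀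
    identity₃ : ∀ N B X → 112 * (2 * N) + (25 + B + 224 * (X * X)) + 223 * (25 + B) ≡
                          224 * (N + (25 + B + X * X))
    identity₃ = solve-∀
    scaled : 224 * (q * g l + X * i) ≤ 224 * (N + (25 + B + X * X))
    scaled = begin
      -- The term linear in `i` is split by 2ab ≤ a² + b² with b = 2X, giving 224Xi ≤ 56i² + 224X².
      -- With the 56i² from l² this makes 112i² ≤ 224N. The later summand 223 * (25 + B) is padding
      -- that lets 224 be factored out.
      224 * (q * g l + X * i)                     ≡⟨ identity₁ q (g l) X i ⟩
      224 * q * g l + 56 * (2 * (i * (2 * X)))    ≤⟨ ℕ.+-mono-≤
        (ℕ.≤-trans (g≤ l) (ℕ.+-monoˡ-≤ B (square l i l≤)))
        (ℕ.*-monoʳ-≤ 56 (2ab≤a²+b² i (2 * X))) ⟩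
      (56 * (i * i) + 25) + B + 56 * (i * i + (2 * X) * (2 * X)) ≡⟨ identity₂ (i * i) X B ⟩
      112 * (i * i) + (25 + B + 224 * (X * X))    ≤⟨ ℕ.+-monoˡ-≤ _ (ℕ.*-monoʳ-≤ 112 i²) ⟩
      112 * (2 * N) + (25 + B + 224 * (X * X))    ≤⟨ ℕ.m≤m+n _ (223 * (25 + B)) ⟩
      112 * (2 * N) + (25 + B + 224 * (X * X)) + 223 * (25 + B) ≡⟨ identity₃ N B X ⟩
      224 * (N + (25 + B + X * X))                ∎

^-distribʳ-* : ∀ n a b → (a * b) ^ n ≡ a ^ n * b ^ n
^-distribʳ-* zero    a b = refl
^-distribʳ-* (suc n) a b = trans (cong (a * b *_) (^-distribʳ-* n a b)) (interchange a b (a ^ n) (b ^ n))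
  where open CommutativeSemigroup ℕ.*-commutativeSemigroup using (interchange)

n<2^n : ∀ n → n < 2 ^ n
n<2^n zero    = s≤s z≤n
n<2^n (suc n) = begin-strict
  suc n         ≤⟨ n<2^n n ⟩
  2 ^ n         <⟨ ℕ.m<m+n (2 ^ n) (ℕ.m^n>0 2 n) ⟩
  2 ^ n + 2 ^ n ≡⟨ cong (2 ^ n +_) (sym (ℕ.+-identityʳ (2 ^ n))) ⟩
  2 ^ suc n     ∎
  where open ℕ.≤-Reasoning

-- The total time is about 2 ^ g(l) times W ^ D, and W contributes 2 ^ (D * k) with k = O(√N). The
-- whole exponent is at most N / q up to a constant, and the rate p / q is at least 1 / q.
combined-time : ∀ {g f} → g ∈o[k²] → PolynomiallyBounded f → ∀ p q e → 0 < p → 0 < q →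
  ∃[ c ] ∀ N l n s t W → let k = suc (row N) in W ≡ s * (s * 2 ^ k) →
    2 ≤ s → l ≤ 1 + 4 * k → n ≤ W → t ≤ f W + 2 ^ g l * n ^ e →
    t ^ q ≤ 2 ^ (p * N) * (s ^ c) ^ q
combined-time {g} {f} g∈o (K , d , f≤) p q@(suc _) e 0<p _ =
  -- `D + D` comes from the two factors `s` in `W`. The constant 2 ^ E, and 2 ^ K as a bound for
  -- `suc K`, become powers of `s` since `s` is at least 2.
  D + D + (E + K) , bound
  where
  D = d + e
  E = proj₁ (exponent≤ g∈o q D)
  open ℕ.≤-Reasoning
  bound : ∀ N l n s t W → let k = suc (row N) in W ≡ s * (s * 2 ^ k) →
    2 ≤ s → l ≤ 1 + 4 * k → n ≤ W → t ≤ f W + 2 ^ g l * n ^ e →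
    t ^ q ≤ 2 ^ (p * N) * (s ^ (D + D + (E + K))) ^ q
  bound N l n s t W refl 2≤s l≤ n≤ t≤ = begin
    t ^ q                                          ≤⟨ ℕ.^-monoˡ-≤ q total ⟩
    (2 ^ (g l + D * k + K) * s ^ (D + D)) ^ q      ≡⟨ ^-distribʳ-* q (2 ^ (g l + D * k + K)) (s ^ (D + D)) ⟩
    (2 ^ (g l + D * k + K)) ^ q * (s ^ (D + D)) ^ q ≡⟨ cong (_* (s ^ (D + D)) ^ q) (ℕ.^-*-assoc 2 (g l + D * k + K) q) ⟩
    2 ^ ((g l + D * k + K) * q) * (s ^ (D + D)) ^ q ≤⟨ ℕ.*-monoˡ-≤ ((s ^ (D + D)) ^ q) (ℕ.^-monoʳ-≤ 2 exponent) ⟩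
    2 ^ (p * N + (E + K) * q) * (s ^ (D + D)) ^ q  ≡⟨ cong (_* (s ^ (D + D)) ^ q) (ℕ.^-distribˡ-+-* 2 (p * N) ((E + K) * q)) ⟩
    2 ^ (p * N) * 2 ^ ((E + K) * q) * (s ^ (D + D)) ^ q ≤⟨ ℕ.*-monoˡ-≤ ((s ^ (D + D)) ^ q) (ℕ.*-monoʳ-≤ (2 ^ (p * N)) (ℕ.^-monoˡ-≤ ((E + K) * q) 2≤s)) ⟩
    2 ^ (p * N) * s ^ ((E + K) * q) * (s ^ (D + D)) ^ q ≡⟨ cong (λ x → 2 ^ (p * N) * x * (s ^ (D + D)) ^ q) (sym (ℕ.^-*-assoc s (E + K) q)) ⟩
    2 ^ (p * N) * (s ^ (E + K)) ^ q * (s ^ (D + D)) ^ q ≡⟨ ℕ.*-assoc (2 ^ (p * N)) _ _ ⟩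
    2 ^ (p * N) * ((s ^ (E + K)) ^ q * (s ^ (D + D)) ^ q) ≡⟨ cong (2 ^ (p * N) *_) powers ⟩
    2 ^ (p * N) * (s ^ (D + D + (E + K))) ^ q      ∎
    where
    k = suc (row N)
    instance
      s≢0 : NonZero s
      s≢0 = >-nonZero (ℕ.≤-trans (s≤s z≤n) 2≤s)
      2^k≢0 : NonZero (2 ^ k)
      2^k≢0 = ℕ.m^n≢0 2 k
      W≢0 : NonZero W
      W≢0 = ℕ.m*n≢0 s (s * 2 ^ k) {{s≢0}} {{ℕ.m*n≢0 s (2 ^ k)}}
    powers : (s ^ (E + K)) ^ q * (s ^ (D + D)) ^ q ≡ (s ^ (D + D + (E + K))) ^ q
    powers = trans (sym (^-distribʳ-* q (s ^ (E + K)) (s ^ (D + D))))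
      (cong (_^ q) (trans (sym (ℕ.^-distribˡ-+-* s (E + K) (D + D))) (cong (s ^_) (ℕ.+-comm (E + K) (D + D)))))
    exponent : (g l + D * k + K) * q ≤ p * N + (E + K) * q
    exponent = begin
      (g l + D * k + K) * q       ≡⟨ ℕ.*-distribʳ-+ q (g l + D * k) K ⟩
      (g l + D * k) * q + K * q   ≡⟨ cong (_+ K * q) (ℕ.*-comm (g l + D * k) q) ⟩
      q * (g l + D * k) + K * q   ≤⟨ ℕ.+-monoˡ-≤ (K * q) (proj₂ (exponent≤ g∈o q D) N l l≤) ⟩
      N + E + K * q               ≤⟨ ℕ.+-monoˡ-≤ (K * q) (ℕ.+-mono-≤ (ℕ.m≤n*m N p {{>-nonZero 0<p}}) (ℕ.m≤m*n E q)) ⟩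
      p * N + E * q + K * q       ≡⟨ ℕ.+-assoc (p * N) (E * q) (K * q) ⟩
      p * N + (E * q + K * q)     ≡⟨ cong (p * N +_) (sym (ℕ.*-distribʳ-+ q E K)) ⟩
      p * N + (E + K) * q         ∎
    W^D : W ^ D ≡ 2 ^ (D * k) * s ^ (D + D)
    W^D = begin-equality
      (s * (s * 2 ^ k)) ^ D         ≡⟨ ^-distribʳ-* D s (s * 2 ^ k) ⟩
      s ^ D * (s * 2 ^ k) ^ D       ≡⟨ cong (s ^ D *_) (^-distribʳ-* D s (2 ^ k)) ⟩
      s ^ D * (s ^ D * (2 ^ k) ^ D) ≡⟨ ℕ.*-assoc (s ^ D) (s ^ D) _ ⟨
      s ^ D * s ^ D * (2 ^ k) ^ D   ≡⟨ cong₂ _*_ (sym (ℕ.^-distribˡ-+-* s D D)) (trans (ℕ.^-*-assoc 2 k D) (cong (2 ^_) (ℕ.*-comm k D))) ⟩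
      s ^ (D + D) * 2 ^ (D * k)     ≡⟨ ℕ.*-comm (s ^ (D + D)) _ ⟩
      2 ^ (D * k) * s ^ (D + D)     ∎
    total : t ≤ 2 ^ (g l + D * k + K) * s ^ (D + D)
    total = begin
      t                                    ≤⟨ t≤ ⟩
      f W + 2 ^ g l * n ^ e                ≤⟨ ℕ.+-mono-≤ (f≤ W) (ℕ.*-monoʳ-≤ (2 ^ g l) (ℕ.^-monoˡ-≤ e n≤)) ⟩
      K * W ^ d + 2 ^ g l * W ^ e          ≤⟨ ℕ.+-mono-≤
        (ℕ.*-mono-≤ (ℕ.m≤n*m K (2 ^ g l) {{ℕ.m^n≢0 2 (g l)}}) (ℕ.^-monoʳ-≤ W (ℕ.m≤m+n d e)))
        (ℕ.*-monoʳ-≤ (2 ^ g l) (ℕ.^-monoʳ-≤ W (ℕ.m≤n+m e d))) ⟩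
      2 ^ g l * K * W ^ D + 2 ^ g l * W ^ D ≡⟨ identity (2 ^ g l) K (W ^ D) ⟩
      2 ^ g l * W ^ D * suc K              ≤⟨ ℕ.*-monoʳ-≤ (2 ^ g l * W ^ D) (n<2^n K) ⟩
      2 ^ g l * W ^ D * 2 ^ K              ≡⟨ cong (λ x → 2 ^ g l * x * 2 ^ K) W^D ⟩
      2 ^ g l * (2 ^ (D * k) * s ^ (D + D)) * 2 ^ K ≡⟨ identity′ (2 ^ g l) (2 ^ (D * k)) (s ^ (D + D)) (2 ^ K) ⟩
      2 ^ g l * 2 ^ (D * k) * 2 ^ K * s ^ (D + D) ≡⟨ cong (_* s ^ (D + D)) (sym (trans
        (ℕ.^-distribˡ-+-* 2 (g l + D * k) K) (cong (_* 2 ^ K) (ℕ.^-distribˡ-+-* 2 (g l) (D * k))))) ⟩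
      2 ^ (g l + D * k + K) * s ^ (D + D)  ∎
      where
      identity : ∀ a K w → a * K * w + a * w ≡ a * w * suc K
      identity = solve-∀
      identity′ : ∀ a b c d → a * (b * c) * d ≡ a * b * d * c
      identity′ = solve-∀

-- The algorithm for 3-CNF-SAT

rawLiteral : ∀ {N} → Literal N → Bool × ℕ
rawLiteral (literal p x) = p , toℕ x

rawClause : ∀ {N} → Clause N → RawClause
rawClause C = map rawLiteral (Vec≤.toList C)

rawFormula : ∀ {N} → 3-CNF N → List RawClause
rawFormula = map rawClause

encodeList-map : ∀ {A B : Set} {f : A → Tree} {g : B → Tree} {h : A → B} →
  (∀ x → f x ≡ g (h x)) → ∀ xs → encodeList f xs ≡ encodeList g (map h xs)
encodeList-map eq []       = refl
encodeList-map eq (x ∷ xs) = cong₂ _∙_ (eq x) (encodeList-map eq xs)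

encodeFormula-raw : ∀ {N} (φ : 3-CNF N) →
  encodeFormula φ ≡ encodeℕ N ∙ encodeList encodeRawClause (rawFormula φ)
encodeFormula-raw φ = cong (_ ∙_)
  (encodeList-map (λ C → encodeList-map (λ _ → refl) (Vec≤.toList C)) φ)

literalValue⁺ : ∀ {N} (α : Assignment N) {p x} → Vec.lookup α x ≡ p → literalValue α (literal p x) ≡ true
literalValue⁺ α {true}  eq = eq
literalValue⁺ α {false} eq = cong not eq

literalValue⁻ : ∀ {N} (α : Assignment N) {p x} → literalValue α (literal p x) ≡ true → Vec.lookup α x ≡ p
literalValue⁻ α {true}          eq = eq
literalValue⁻ α {false} {x} eq with false ← Vec.lookup α x = refl

bit-toList : ∀ {N} (α : Assignment N) x → bit (Vec.toList α) (toℕ x) ≡ Vec.lookup α x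
bit-toList (b ∷ α) zero    = refl
bit-toList (b ∷ α) (suc x) = bit-toList α x

satisfiable⁺ : ∀ {N} {φ : 3-CNF N} {α} → RawSatisfies α (rawFormula φ) → Satisfiable φ
satisfiable⁺ {α = α} sat = tabulate (α ∘ toℕ) , All.tabulate λ C∈ →
  let p , x , px∈ , eq = sat (∈-map⁺ rawClause C∈)
      ℓ , ℓ∈ , px≡ = ∈-map⁻ rawLiteral px∈
  in lose ℓ∈ (value px≡ eq)
  where
  value : ∀ {ℓ p x} → (p , x) ≡ rawLiteral ℓ → α x ≡ p → literalValue (tabulate (α ∘ toℕ)) ℓ ≡ true
  value {ℓ = literal p y} refl eq =
    literalValue⁺ (tabulate (α ∘ toℕ)) {x = y} (trans (Vec.lookup∘tabulate (α ∘ toℕ) y) eq)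

satisfiable⁻ : ∀ {N} {φ : 3-CNF N} → Satisfiable φ → ∃[ α ] RawSatisfies α (rawFormula φ)
satisfiable⁻ {φ = φ} (α , sat) = bit (Vec.toList α) , satisfied
  where
  satisfied : RawSatisfies (bit (Vec.toList α)) (rawFormula φ)
  satisfied c∈ with C , C∈ , refl ← ∈-map⁻ rawClause c∈
    with literal p x , ℓ∈ , eq ← find (All.lookup sat C∈) =
    p , toℕ x , ∈-map⁺ rawLiteral ℓ∈ , trans (bit-toList α x) (literalValue⁻ α eq)

rawFormula-below : ∀ {N} (φ : 3-CNF N) → VariablesBelow N (rawFormula φ)
rawFormula-below φ c∈ px∈
  with C , C∈ , refl ← ∈-map⁻ rawClause c∈
  with literal p x , ℓ∈ , refl ← ∈-map⁻ rawLiteral px∈ = Fin.toℕ<n x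

length-rawClause : ∀ {N} (C : Clause N) → length (rawClause C) ≤ 3
length-rawClause C@(v Vec≤., l≤3) = begin
  length (rawClause C)         ≡⟨ length-map rawLiteral (Vec≤.toList C) ⟩
  length (Vec≤.toList C)       ≡⟨ Vec.length-toList v ⟩
  -- The length bound stored in a clause is proof-irrelevant; being decidable, it can be recovered.
  Vec≤.Vec≤.length C           ≤⟨ recompute (Vec≤.Vec≤.length C ≤? 3) l≤3 ⟩
  3                            ∎
  where open ℕ.≤-Reasoning

length-addTautologies-clause : ∀ {N c} (φ : 3-CNF N) → c ∈ addTautologies N (rawFormula φ) → length c ≤ 3
length-addTautologies-clause {N} φ c∈ with addTautologies-∈ N c∈
... | inj₁ (x , _ , refl) = ℕ.n≤1+n 2
... | inj₂ c∈φ with C , _ , refl ← ∈-map⁻ rawClause c∈φ = length-rawClause C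

size-bound : ∀ {N} (φ : 3-CNF N) → 3 + (N + length φ) ≤ size φ
size-bound {N} φ = begin
  3 + (N + length φ)         ≡⟨ cong (2 +_) (sym (ℕ.+-suc N (length φ))) ⟩
  1 + (suc N + suc (length φ)) ≤⟨ s≤s (ℕ.+-mono-≤ (unary N) (list φ)) ⟩
  size φ                     ∎
  where
  open ℕ.≤-Reasoning
  unary : ∀ n → suc n ≤ treeSize (encodeℕ n)
  unary zero    = ℕ.≤-refl
  unary (suc n) = s≤s (ℕ.≤-trans (unary n) (ℕ.n≤1+n _))
  list : ∀ {A : Set} {f : A → Tree} xs → suc (length xs) ≤ treeSize (encodeList f xs)
  list []       = ℕ.≤-refl
  list (x ∷ xs) = s≤s (ℕ.≤-trans (list xs) (ℕ.m≤n+m _ _))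

length-concatMap≤ : ∀ {A B : Set} {f : A → List B} {b} xs →
  (∀ {x} → x ∈ xs → length (f x) ≤ b) → length (concatMap f xs) ≤ length xs * b
length-concatMap≤ []       le = z≤n
length-concatMap≤ {f = f} (x ∷ xs) le = ℕ.≤-trans (ℕ.≤-reflexive (length-++ (f x)))
  (ℕ.+-mono-≤ (le (here refl)) (length-concatMap≤ xs (le ∘ there)))

length-labels≤ : ∀ ys gs → (∀ {g c} → (g , c) ∈ gs → length c ≤ 3) →
  length (labels ys gs) ≤ length gs * (3 * length ys)
length-labels≤ ys gs le = length-concatMap≤ gs λ {(g , c)} gc∈ →
  ℕ.≤-trans (length-concatMap≤ c (λ {px} _ → literalLabels≤ g px)) (ℕ.*-monoˡ-≤ (length ys) (le gc∈))
  where
  literalLabels≤ : ∀ g px → length (literalLabels ys g px) ≤ length ys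
  literalLabels≤ g (p , x) = ℕ.≤-trans
    (length-concatMap≤ {b = 1} ys λ {y} _ → atMostOne (bit y (column x) xor p))
    (ℕ.≤-reflexive (ℕ.*-identityʳ (length ys)))
    where
    atMostOne : ∀ b {y} → length {A = Label} (if b then [] else (g , row x , y) ∷ []) ≤ 1
    atMostOne true  = z≤n
    atMostOne false = ℕ.≤-refl

-- Assembling the program

solver : ∀ {k} → Command (suc k) → Command (2 + k)
solver C =
  -- The compiled term expects an environment whose only entry is the input.
  zero ≔ cons (var zero) nil ⨾
  compile reductionTerm ⨾
  suc zero ≔ tl (hd (var zero)) ⨾
  zero ≔ hd (hd (var zero)) ⨾
  reserve C ⨾
  zero ≔ cons (cons (var zero) (var (suc zero))) nil ⨾
  -- Variable one still holds the target. It may stay there, as compiled terms accept any contents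
  -- of the second stack.
  compile answerTerm ⨾
  zero ≔ hd (var zero)

-- The constant is the total cost 4 + 4 + 4 + 6 + 3 of the five assignments in `solver`.
overhead : ℕ → ℕ → ℕ
overhead k W = 21 + (steps {k} reductionTerm W + steps {k} answerTerm W)

overhead-bounded : ∀ k → PolynomiallyBounded (overhead k)
overhead-bounded k =
  +-bounded (constant-bounded 21) (+-bounded (steps-bounded {k} reductionTerm) (steps-bounded {k} answerTerm))

solver-runs : ∀ {k n W input m σ t} {C : Command (suc k)} {G : Graph n} {S : Subset n} →
  Evaluates W (input ∷ []) reductionTerm (encodeGraph G ∙ encodeℕ m) →
  C ⊢ encodeGraph G ∷ replicate k nil ⇒ encodeSubset S ∷ σ [ t ] → n ≤ W → m ≤ W →
  ∃[ τ ] solver C ⊢ input ∷ replicate (suc k) nil ⇒ encodeBool (does (m ≤? ∣ S ∣)) ∷ τ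
    within (overhead k W + t)
solver-runs {k} {W = W} {m = m} {σ} {t} {S = S} reduces runs n≤ m≤ =
  _ , weaken (ℕ.≤-reflexive (identity (steps {k} reductionTerm W) (steps {k} answerTerm W) t))
  ( assigns _ _
  then compile-runs reduces nil nil (replicate k nil)
  then assigns _ _
  then assigns _ _
  then (t , reserve-runs (encodeℕ m) runs , ℕ.≤-refl)
  then assigns _ _
  then compile-runs (answer-evaluates S m n≤ m≤) nil (encodeℕ m) σ
  then assigns _ _)
  where
  identity : ∀ a b t → 4 + (a + (4 + (4 + (t + (6 + (b + 3)))))) ≡ 21 + (a + b) + t
  identity = solve-∀

-- This dominates the number of vertices: one factor `size φ` is for the cliques, the other for the
-- at most 3 literals in each, and the power of 2 for the bit vectors.
timeParameter : ∀ {N} → 3-CNF N → ℕ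
timeParameter {N} φ = size φ * (size φ * 2 ^ suc (row N))

record Reduced {N} (φ : 3-CNF N) : Set where
  field
    {order} : ℕ
    G       : Graph order
    target  : ℕ
    reduces : Evaluates (timeParameter φ) (encodeFormula φ ∷ []) reductionTerm
                (encodeGraph G ∙ encodeℕ target)
    target≤ : target ≤ timeParameter φ
    order≤  : order ≤ timeParameter φ
    lrw-small : lrw G ≤ 1 + 4 * suc (row N)
    decides : ∀ {S} → IsMaximumIndependent G S → Reflects (Satisfiable φ) (does (target ≤? ∣ S ∣))

module _ {N : ℕ} (φ : 3-CNF N) (ls : List Label)
  (ls≡ : labels (bitVectors (suc (row N))) (groups N (rawFormula φ)) ≡ ls) where

  private
    cs all : List RawClause
    cs  = rawFormula φ
    all = addTautologies N cs

    k s W : ℕ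
    k = suc (row N)
    s = size φ
    W = timeParameter φ

    ys : List (List Bool)
    ys = bitVectors k

    ls⁻ : ∀ {l} → l ∈ ls → IsVertexLabel N cs l
    ls⁻ {l} l∈ = labels⁻ {ys} {groups N cs} (subst (l ∈_) (sym ls≡) l∈)

    ls⁺ : ∀ {l} → IsVertexLabel N cs l → l ∈ ls
    ls⁺ {l} is = subst (l ∈_) ls≡ (labels⁺ {ys} {groups N cs} is)

    instance
      s≢0 : NonZero s
      s≢0 = >-nonZero (ℕ.≤-trans (s≤s z≤n) (size-bound φ))
      2^k≢0 : NonZero (2 ^ k)
      2^k≢0 = ℕ.m^n≢0 2 k
      s2^k≢0 : NonZero (s * 2 ^ k)
      s2^k≢0 = ℕ.m*n≢0 s (2 ^ k)

    s≤W : s ≤ W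
    s≤W = ℕ.m≤m*n s (s * 2 ^ k)

    2^k≤W : 2 ^ k ≤ W
    2^k≤W = ℕ.≤-trans (ℕ.m≤n*m (2 ^ k) s) (ℕ.m≤n*m (s * 2 ^ k) s)

    all≤s : length all ≤ s
    all≤s = ℕ.≤-trans (ℕ.≤-reflexive
      (trans (length-addTautologies N cs) (cong (N +_) (length-map rawClause φ))))
      (ℕ.≤-trans (ℕ.m≤n+m _ 3) (size-bound φ))

    N<s : N < s
    N<s = ℕ.≤-trans (s≤s (ℕ.≤-trans (ℕ.m≤m+n N (length φ)) (ℕ.m≤n+m _ 2))) (size-bound φ)

    3≤s : 3 ≤ s
    3≤s = ℕ.≤-trans (ℕ.m≤m+n 3 _) (size-bound φ)

    k≤s : k ≤ s
    k≤s = ℕ.≤-trans (s≤s (row≤ N)) N<s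

    below : VariablesBelow N all
    below = addTautologies-below N (rawFormula-below φ)

    ls≤W : length ls ≤ W
    ls≤W = begin
      length ls                                ≡⟨ cong length ls≡ ⟨
      length (labels ys (groups N cs))         ≤⟨ length-labels≤ ys (groups N cs)
        (λ gc∈ → length-addTautologies-clause φ (number-∈ gc∈)) ⟩
      length (groups N cs) * (3 * length ys)   ≡⟨ cong₂ (λ m n → m * (3 * n)) (length-number all) (length-bitVectors k) ⟩
      length all * (3 * 2 ^ k)                 ≤⟨ ℕ.*-mono-≤ all≤s (ℕ.*-monoˡ-≤ (2 ^ k) 3≤s) ⟩
      W                                        ∎
      where open ℕ.≤-Reasoning

    label-bounds : ∀ {g i y} → (g , i , y) ∈ ls → g < length all × i < k
    label-bounds l∈ = go (ls⁻ l∈)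
      where
      go : ∀ {g i y} → IsVertexLabel N cs (g , i , y) → g < length all × i < k
      go (_ , _ , _ , _ , _ , gc∈ , px∈ , _ , _ , refl) =
        number-< gc∈ , s≤s (row-mono (ℕ.<⇒≤ (below (number-∈ gc∈) px∈)))

    vs≤W : length (number ls) ≤ W
    vs≤W = ℕ.≤-trans (ℕ.≤-reflexive (length-number ls)) ls≤W

    all≤W : length all ≤ W
    all≤W = ℕ.≤-trans all≤s s≤W

    N≤W : N ≤ W
    N≤W = ℕ.≤-trans (ℕ.<⇒≤ N<s) s≤W

    encoding-evaluates : Evaluates W (encodeFormula φ ∷ []) reductionTerm
      (encodeGraph (graph (number ls)) ∙ encodeℕ (length all))
    encoding-evaluates rewrite encodeFormula-raw φ | encodeGraph-graph (number ls) =
      reduction-evaluates N cs ls≡ N≤W (ℕ.≤-trans k≤s s≤W) 2^k≤W all≤W vs≤W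
        (All.tabulate λ gc∈ →
          ℕ.≤-trans (length-addTautologies-clause φ (number-∈ gc∈)) (ℕ.≤-trans 3≤s s≤W) ,
          All.tabulate λ {(p , x)} px∈ →
            let x≤W = ℕ.≤-trans (ℕ.<⇒≤ (below (number-∈ gc∈) px∈)) N≤W in
            x≤W , ℕ.≤-trans (ℕ.≤-trans (column≤row x) (row≤ x)) x≤W)
        (All.tabulate λ v∈ → let g< , i< = label-bounds (number-∈ v∈) in
          ℕ.≤-trans (ℕ.<⇒≤ (number-< v∈)) ls≤W , ℕ.≤-trans (ℕ.<⇒≤ g<) all≤W ,
          ℕ.≤-trans (ℕ.<⇒≤ i<) (ℕ.≤-trans k≤s s≤W))

    satisfiable? : ∀ {S} → IsMaximumIndependent (graph (number ls)) S → Dec (Satisfiable φ)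
    satisfiable? {S} (independent , maximum) = map′ sound complete (length all ≤? ∣ S ∣)
      where
      open Reduction N cs (rawFormula-below φ) ls ls⁻ ls⁺ using (module Soundness; module Completeness)
      sound : length all ≤ ∣ S ∣ → Satisfiable φ
      sound large = satisfiable⁺ (Soundness.satisfied independent large)
      complete : Satisfiable φ → length all ≤ ∣ S ∣
      complete sat =
        let T , T-independent , large = Completeness.independent-set (proj₂ (satisfiable⁻ sat)) in
        ℕ.≤-trans large (maximum T T-independent)

    rows : All (λ (_ , i , _) → i < k) ls
    rows = All.tabulate λ l∈ → proj₂ (label-bounds l∈)

    descending : Descending ls
    descending = subst Descending ls≡ (labels-descending ys all)

    lrw-bound : lrw (graph (number ls)) ≤ 1 + 4 * suc (row N)
    lrw-bound = lrw-graph≤ ls (suc (row N)) descending rows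

  reduced : Reduced φ
  reduced = record
    { G       = graph (number ls)
    ; target  = length all
    ; reduces = encoding-evaluates
    ; target≤ = all≤W
    ; order≤  = vs≤W
    ; lrw-small   = lrw-bound
    ; decides = λ {S} maximum → Dec.proof (satisfiable? {S} maximum)
    }

theorem1p1 :
    ETH →
    ¬ (∃[ P ] ∃[ g ] ∃[ c ] (g ∈o[k²] × SolvesIndependentSetIn P (timeBound g c)))
theorem1p1 (p , q , 0<p , 0<q , hard) (program {extra} C , g , e , g∈o , solves) =
  hard (program (solver C) , c , λ φ → solvesSAT φ (reduced φ _ refl))
  where
  c,time≤ = combined-time g∈o (overhead-bounded extra) p q e 0<p 0<q
  c = proj₁ c,time≤
  time≤ : ∀ {N} (φ : 3-CNF N) (r : Reduced φ) {t T} → t ≤ timeBound g e (Reduced.G r) →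
    T ≤ overhead extra (timeParameter φ) + t → T ^ q ≤ 2 ^ (p * N) * (size φ ^ c) ^ q
  time≤ {N} φ r {t} {T} t≤ T≤ =
    proj₂ c,time≤ N (lrw (Reduced.G r)) (Reduced.order r ⊔ 1) (size φ) T (timeParameter φ) refl
      (ℕ.≤-trans (ℕ.m≤m+n 2 _) (size-bound φ)) (Reduced.lrw-small r)
      -- The graph may be empty, in which case `timeBound` takes 1 for the number of vertices.
      (ℕ.⊔-lub (Reduced.order≤ r) 1≤W)
      (ℕ.≤-trans T≤ (ℕ.+-monoʳ-≤ (overhead extra (timeParameter φ)) t≤))
    where
    1≤s : 1 ≤ size φ
    1≤s = ℕ.≤-trans (ℕ.m≤m+n 1 _) (size-bound φ)
    1≤W : 1 ≤ timeParameter φ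
    1≤W = ℕ.*-mono-≤ 1≤s (ℕ.*-mono-≤ 1≤s (ℕ.m^n>0 2 (suc (row N))))
  solvesSAT : ∀ {N} (φ : 3-CNF N) → Reduced φ → ∃[ b ] ∃[ t ]
    (program (solver C) on encodeFormula φ yields encodeBool b after t) ×
    Reflects (Satisfiable φ) b × t ^ q ≤ 2 ^ (p * N) * (size φ ^ c) ^ q
  solvesSAT φ r =
    let S , t , (σ , runs) , maximum , t≤ = solves (Reduced.G r)
        τ , T , runs′ , T≤ = solver-runs {G = Reduced.G r} {S} (Reduced.reduces r) runs
          (Reduced.order≤ r) (Reduced.target≤ r)
    in does (Reduced.target r ≤? ∣ S ∣) , T , (τ , runs′) , Reduced.decides r {S} maximum , time≤ φ r t≤ T≤
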